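{- For each variety $\mathbf{K}\in\Xi(\mathbf{S4})$, $$\mathsf{Log}(\sigma(\rho(\mathbf{K})))=Schem(\mathsf{Log}(\mathbf{K})^{\Box}).$$ Consequently, a logic (in the sense of axiomatic extension) $L\in\mathbf{NExt}(\mathsf{S4})$ is $\Box$-maximal if and only if it is the greatest modal companion of $\rho(L)$.
   Context: $\mathbf{S4}$ is the variety of S4-algebras: Boolean algebras with a unary $\Box$ satisfying $\Box1=1$, $\Box(a\wedge b)=\Box a\wedge\Box b$, $\Box a\le a$, $\Box a\le\Box\Box a$. In this statement $\Xi(\mathbf{S4})$ is the lattice of subvarieties of $\mathbf{S4}$. $\mathbf{NExt}(\mathsf{S4})$ is the lattice of normal axiomatic extensions of $\mathsf{S4}$ (sets of modal formulas), and $\Lambda(\mathsf{IPC})$ is the lattice of axiomatic extensions (superintuitionistic logics) of $\mathsf{IPC}$. For a class $\mathbf{K}$ of algebras, $\mathsf{Log}(\mathbf{K})$ is the set of formulas $\phi$ such that $\phi\approx1$ is valid in all members of $\mathbf{K}$. The translation $GMT$ from intuitionistic to modal formulas: $GMT(p)=\Box p$, $GMT(\top)=\top$, $GMT(\bot)=\bot$, $GMT$ commutes with $\wedge,\vee$, and $GMT(\phi\to\psi)=\Box(\neg GMT(\phi)\vee GMT(\psi))$. $M\in\mathbf{NExt}(\mathsf{S4})$ is a modal companion of $L\in\Lambda(\mathsf{IPC})$ if for all intuitionistic $\phi$: $\phi\in L\iff GMT(\phi)\in M$. For $M\in\mathbf{NExt}(\mathsf{S4})$, $\rho(M)=\{\phi:GMT(\phi)\in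 M\}\in\Lambda(\mathsf{IPC})$. For an S4-algebra $\mathcal{B}$, $\mathcal{B}_\Box=\{a\in B:a=\Box a\}$ is a Heyting algebra with the inherited $0,1,\wedge,\vee$ and implication $\Box(\neg a\vee b)$. For a variety $\mathbf{K}$ of S4-algebras, $\rho(\mathbf{K})=\{\mathcal{B}_\Box:\mathcal{B}\in\mathbf{K}\}$. For a Heyting algebra $\mathcal{H}$, $B(\mathcal{H})$ is its Boolean envelope: the Boolean algebra generated by $\mathcal{H}$, realized inside the powerset of the set of prime filters of $\mathcal{H}$ via $a\mapsto\{x:a\in x\}$, with $\Box\bigl(\bigwedge_{i=1}^n(\neg c_i\vee d_i)\bigr)=\bigwedge_{i=1}^n(c_i\to d_i)$ for $c_i,d_i\in H$, where $\to$ is Heyting implication; it is an S4-algebra. For a variety $\mathbf{P}$ of Heyting algebras, $\sigma(\mathbf{P})=\mathbb{HSP}\{B(\mathcal{H}):\mathcal{H}\in\mathbf{P}\}$. For $L\in\mathbf{NExt}(\mathsf{S4})$, its $\Box$-variant is $L^\Box=\{\phi:\phi[\Box\overline p/\overline p]\in L\}$, where $\phi[\Box\overline p/\overline p]$ substitutes $\Box q$ for each proposition letter $q$. For a $\Box$-variant $L'$, $Schem(L')=\{\phi:\forall\overline\psi,\ \phi[\overline\psi/\overline p]\in L'\}$, with $\overline\psi$ ranging over substitutions of modal formulas for proposition letters. $L$ is $\Box$-maximal if for every $S\in\mathbf{NExt}(\mathsf{S4})$, $L^\Box=S^\Box$ implies $S\subseteq L$. -}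

module Defs where

open import Algebra.Lattice.Bundles using (BooleanAlgebra)
import Algebra.Lattice.Properties.BooleanAlgebra as BooleanAlgebraProperties
open import Data.Bool.Base using (Bool; true; false; not)
  renaming (_∧_ to _&&_; _∨_ to _||_)
open import Data.List.Base using (List; foldr; map)
open import Data.Nat.Base using (ℕ)
open import Data.Product.Base using (Σ-syntax; ∃-syntax; _×_; _,_; proj₁; proj₂)
open import Data.Sum.Base using (_⊎_)
open import Function.Base using (_∘_)
open import Function.Bundles using (_⇔_)
open import Function.Definitions using (Congruent; Injective; Surjective)
open import Level using (Level; _⊔_) renaming (suc to lsuc)
open import Relation.Binary.Bundles using (Poset)
open import Relation.Binary.Lattice.Bundles using (HeytingAlgebra)
open import Relation.Binary.PropositionalEquality using (_≡_; refl)
open import Relation.Nullary.Negation using () renaming (¬_ to Not_)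
open import Relation.Unary using (Pred; _∈_; _⊆_; _≐_; _∩_; _∪_; ∁; U; ∅)

private
  variable
    ℓ k m : Level

------------------------------------------------------------------------
-- Modal and intuitionistic formulas

data Modal : Set where
  var     : ℕ → Modal
  ⊤̇ ⊥̇     : Modal
  ¬̇_ □̇_   : Modal → Modal
  _∧̇_ _∨̇_ : Modal → Modal → Modal

data Int : Set where
  var         : ℕ → Int
  ⊤̇ ⊥̇         : Int
  _∧̇_ _∨̇_ _⇒̇_ : Int → Int → Int

infix  9 ¬̇_ □̇_
infixr 8 _∧̇_
infixr 7 _∨̇_
infixr 6 _⇒̇_ _⊃_

_⊃_ : Modal → Modal → Modal
φ ⊃ ψ = ¬̇ φ ∨̇ ψ

infixl 10 _[_] _[_]ⁱ

_[_] : Modal → (ℕ → Modal) → Modal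
var p   [ s ] = s p
⊤̇       [ s ] = ⊤̇
⊥̇       [ s ] = ⊥̇
(¬̇ φ)   [ s ] = ¬̇ (φ [ s ])
(□̇ φ)   [ s ] = □̇ (φ [ s ])
(φ ∧̇ ψ) [ s ] = φ [ s ] ∧̇ ψ [ s ]
(φ ∨̇ ψ) [ s ] = φ [ s ] ∨̇ ψ [ s ]

_[_]ⁱ : Int → (ℕ → Int) → Int
var p   [ s ]ⁱ = s p
⊤̇       [ s ]ⁱ = ⊤̇
⊥̇       [ s ]ⁱ = ⊥̇
(φ ∧̇ ψ) [ s ]ⁱ = φ [ s ]ⁱ ∧̇ ψ [ s ]ⁱ
(φ ∨̇ ψ) [ s ]ⁱ = φ [ s ]ⁱ ∨̇ ψ [ s ]ⁱ
(φ ⇒̇ ψ) [ s ]ⁱ = φ [ s ]ⁱ ⇒̇ ψ [ s ]ⁱ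

GMT : Int → Modal
GMT (var p) = □̇ var p
GMT ⊤̇       = ⊤̇
GMT ⊥̇       = ⊥̇
GMT (φ ∧̇ ψ) = GMT φ ∧̇ GMT ψ
GMT (φ ∨̇ ψ) = GMT φ ∨̇ GMT ψ
GMT (φ ⇒̇ ψ) = □̇ (¬̇ GMT φ ∨̇ GMT ψ)

------------------------------------------------------------------------
-- The logics S4 and IPC, and their axiomatic extensions

-- v assigns truth values to letters and boxed formulas, which are the
-- atoms of classical propositional logic here; its other values are
-- ignored.
truth : (Modal → Bool) → Modal → Bool
truth v (var p) = v (var p)
truth v ⊤̇       = true
truth v ⊥̇       = false
truth v (¬̇ φ)   = not (truth v φ)
truth v (□̇ φ)   = v (□̇ φ)
truth v (φ ∧̇ ψ) = truth v φ && truth v ψ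
truth v (φ ∨̇ ψ) = truth v φ || truth v ψ

Tautology : Pred Modal _
Tautology φ = ∀ v → truth v φ ≡ true

data S4 : Modal → Set where
  taut : ∀ {φ} → Tautology φ → S4 φ
  K    : ∀ φ ψ → S4 (□̇ (φ ⊃ ψ) ⊃ □̇ φ ⊃ □̇ ψ)
  T    : ∀ φ → S4 (□̇ φ ⊃ φ)
  4′   : ∀ φ → S4 (□̇ φ ⊃ □̇ □̇ φ)
  mp   : ∀ {φ ψ} → S4 (φ ⊃ ψ) → S4 φ → S4 ψ
  nec  : ∀ {φ} → S4 φ → S4 (□̇ φ)

data IPC : Int → Set where
  ⇒-K  : ∀ φ ψ → IPC (φ ⇒̇ ψ ⇒̇ φ)
  ⇒-S  : ∀ φ ψ χ → IPC ((φ ⇒̇ ψ ⇒̇ χ) ⇒̇ (φ ⇒̇ ψ) ⇒̇ φ ⇒̇ χ)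
  ∧-I  : ∀ φ ψ → IPC (φ ⇒̇ ψ ⇒̇ φ ∧̇ ψ)
  ∧-E₁ : ∀ φ ψ → IPC (φ ∧̇ ψ ⇒̇ φ)
  ∧-E₂ : ∀ φ ψ → IPC (φ ∧̇ ψ ⇒̇ ψ)
  ∨-I₁ : ∀ φ ψ → IPC (φ ⇒̇ φ ∨̇ ψ)
  ∨-I₂ : ∀ φ ψ → IPC (ψ ⇒̇ φ ∨̇ ψ)
  ∨-E  : ∀ φ ψ χ → IPC ((φ ⇒̇ χ) ⇒̇ (ψ ⇒̇ χ) ⇒̇ φ ∨̇ ψ ⇒̇ χ)
  ⊤-I  : IPC ⊤̇
  ⊥-E  : ∀ φ → IPC (⊥̇ ⇒̇ φ)
  mp   : ∀ {φ ψ} → IPC (φ ⇒̇ ψ) → IPC φ → IPC ψ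

record NExtS4 m : Set (lsuc m) where
  field
    theorems   : Pred Modal m
    S4⊆        : S4 ⊆ theorems
    mp-closed  : ∀ {φ ψ} → φ ⊃ ψ ∈ theorems → φ ∈ theorems → ψ ∈ theorems
    nec-closed : ∀ {φ} → φ ∈ theorems → □̇ φ ∈ theorems
    sub-closed : ∀ {φ} s → φ ∈ theorems → φ [ s ] ∈ theorems

record ΛIPC m : Set (lsuc m) where
  field
    theorems   : Pred Int m
    IPC⊆       : IPC ⊆ theorems
    mp-closed  : ∀ {φ ψ} → φ ⇒̇ ψ ∈ theorems → φ ∈ theorems → ψ ∈ theorems
    sub-closed : ∀ {φ} s → φ ∈ theorems → φ [ s ]ⁱ ∈ theorems

open NExtS4 using () renaming (theorems to thmᴹ) public
open ΛIPC using () renaming (theorems to thmᴵ) public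

------------------------------------------------------------------------
-- Modal companions

module GMT-sound (M : NExtS4 m) where
  open NExtS4 M

  ⊢_ : Pred Modal m
  ⊢_ = theorems

  tt₀ : ∀ {φ} → Tautology φ → ⊢ φ
  tt₀ t = S4⊆ (taut t)

  tt₁ : ∀ {α φ} → Tautology (α ⊃ φ) → ⊢ α → ⊢ φ
  tt₁ t a = mp-closed (tt₀ t) a

  tt₂ : ∀ {α β φ} → Tautology (α ⊃ β ⊃ φ) → ⊢ α → ⊢ β → ⊢ φ
  tt₂ t a b = mp-closed (tt₁ t a) b

  ⊃-refl : ∀ φ → ⊢ (φ ⊃ φ)
  ⊃-refl φ = tt₀ λ v → go (truth v φ)
    where
    go : ∀ a → not a || a ≡ true
    go true = refl
    go false = refl

  ⊃-trans : ∀ {φ ψ χ} → ⊢ (φ ⊃ ψ) → ⊢ (ψ ⊃ χ) → ⊢ (φ ⊃ χ)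
  ⊃-trans {φ} {ψ} {χ} = tt₂ λ v → go (truth v φ) (truth v ψ) (truth v χ)
    where
    go : ∀ a b c → not (not a || b) || (not (not b || c) || (not a || c)) ≡ true
    go true  true  true  = refl
    go true  true  false = refl
    go true  false c     = refl
    go false true  true  = refl
    go false true  false = refl
    go false false c     = refl

  ∧-E₁ᴹ : ∀ φ ψ → ⊢ (φ ∧̇ ψ ⊃ φ)
  ∧-E₁ᴹ φ ψ = tt₀ λ v → go (truth v φ) (truth v ψ)
    where
    go : ∀ a b → not (a && b) || a ≡ true
    go true  true  = refl
    go true  false = refl
    go false b     = refl

  ∧-E₂ᴹ : ∀ φ ψ → ⊢ (φ ∧̇ ψ ⊃ ψ)
  ∧-E₂ᴹ φ ψ = tt₀ λ v → go (truth v φ) (truth v ψ)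
    where
    go : ∀ a b → not (a && b) || b ≡ true
    go true  true  = refl
    go true  false = refl
    go false b     = refl

  pair : ∀ {χ φ ψ} → ⊢ (χ ⊃ φ) → ⊢ (χ ⊃ ψ) → ⊢ (χ ⊃ φ ∧̇ ψ)
  pair {χ} {φ} {ψ} = tt₂ λ v → go (truth v χ) (truth v φ) (truth v ψ)
    where
    go : ∀ a b c → not (not a || b) || (not (not a || c) || (not a || b && c)) ≡ true
    go true  true  true  = refl
    go true  true  false = refl
    go true  false c     = refl
    go false b     true  = refl
    go false b     false = refl

  ∨-I₁ᴹ : ∀ φ ψ → ⊢ (φ ⊃ φ ∨̇ ψ)
  ∨-I₁ᴹ φ ψ = tt₀ λ v → go (truth v φ) (truth v ψ)
    where
    go : ∀ a b → not a || (a || b) ≡ true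
    go true  b = refl
    go false b = refl

  ∨-I₂ᴹ : ∀ φ ψ → ⊢ (ψ ⊃ φ ∨̇ ψ)
  ∨-I₂ᴹ φ ψ = tt₀ λ v → go (truth v φ) (truth v ψ)
    where
    go : ∀ a b → not b || (a || b) ≡ true
    go true  true  = refl
    go true  false = refl
    go false true  = refl
    go false false = refl

  cases : ∀ {φ ψ χ} → ⊢ (φ ⊃ χ) → ⊢ (ψ ⊃ χ) → ⊢ (φ ∨̇ ψ ⊃ χ)
  cases {φ} {ψ} {χ} = tt₂ λ v → go (truth v φ) (truth v ψ) (truth v χ)
    where
    go : ∀ a b c →
         not (not a || c) || (not (not b || c) || (not (a || b) || c)) ≡ true
    go true  true  true  = refl
    go true  true  false = refl
    go true  false true  = refl
    go true  false false = refl
    go false true  true  = refl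
    go false true  false = refl
    go false false c     = refl

  curry : ∀ {φ ψ χ} → ⊢ (φ ∧̇ ψ ⊃ χ) → ⊢ (φ ⊃ ψ ⊃ χ)
  curry {φ} {ψ} {χ} = tt₁ λ v → go (truth v φ) (truth v ψ) (truth v χ)
    where
    go : ∀ a b c → not (not (a && b) || c) || (not a || (not b || c)) ≡ true
    go true  true  true  = refl
    go true  true  false = refl
    go true  false c     = refl
    go false b     c     = refl

  uncurry : ∀ {φ ψ χ} → ⊢ (φ ⊃ ψ ⊃ χ) → ⊢ (φ ∧̇ ψ ⊃ χ)
  uncurry {φ} {ψ} {χ} = tt₁ λ v → go (truth v φ) (truth v ψ) (truth v χ)
    where
    go : ∀ a b c → not (not a || (not b || c)) || (not (a && b) || c) ≡ true
    go true  true  true  = refl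
    go true  true  false = refl
    go true  false c     = refl
    go false b     c     = refl

  const : ∀ {φ} ψ → ⊢ φ → ⊢ (ψ ⊃ φ)
  const {φ} ψ = tt₁ λ v → go (truth v φ) (truth v ψ)
    where
    go : ∀ a b → not a || (not b || a) ≡ true
    go true  true  = refl
    go true  false = refl
    go false b     = refl

  efq : ∀ φ → ⊢ (⊥̇ ⊃ φ)
  efq φ = tt₀ λ v → refl

  ap : ∀ {χ φ ψ} → ⊢ (χ ⊃ φ ⊃ ψ) → ⊢ (χ ⊃ φ) → ⊢ (χ ⊃ ψ)
  ap {χ} {φ} {ψ} = tt₂ λ v → go (truth v χ) (truth v φ) (truth v ψ)
    where
    go : ∀ a b c →
         not (not a || (not b || c)) || (not (not a || b) || (not a || c)) ≡ true
    go true  true  true  = refl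
    go true  true  false = refl
    go true  false c     = refl
    go false true  c     = refl
    go false false c     = refl

  □-mono : ∀ {φ ψ} → ⊢ (φ ⊃ ψ) → ⊢ (□̇ φ ⊃ □̇ ψ)
  □-mono {φ} {ψ} p = mp-closed (S4⊆ (K φ ψ)) (nec-closed p)

  Persistent : Pred Modal m
  Persistent φ = ⊢ (φ ⊃ □̇ φ)

  □-pers : ∀ φ → Persistent (□̇ φ)
  □-pers φ = S4⊆ (4′ φ)

  ∧-pers : ∀ {φ ψ} → Persistent φ → Persistent ψ → Persistent (φ ∧̇ ψ)
  ∧-pers {φ} {ψ} p q =
    ap (⊃-trans (∧-E₁ᴹ φ ψ)
         (⊃-trans p (⊃-trans (□-mono (curry (⊃-refl (φ ∧̇ ψ))))
                             (S4⊆ (K ψ (φ ∧̇ ψ))))))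
       (⊃-trans (∧-E₂ᴹ φ ψ) q)

  GMT-pers : ∀ φ → Persistent (GMT φ)
  GMT-pers (var p) = □-pers (var p)
  GMT-pers ⊤̇       = const ⊤̇ (nec-closed (tt₀ λ v → refl))
  GMT-pers ⊥̇       = efq (□̇ ⊥̇)
  GMT-pers (φ ∧̇ ψ) = ∧-pers (GMT-pers φ) (GMT-pers ψ)
  GMT-pers (φ ∨̇ ψ) =
    cases (⊃-trans (GMT-pers φ) (□-mono (∨-I₁ᴹ (GMT φ) (GMT ψ))))
          (⊃-trans (GMT-pers ψ) (□-mono (∨-I₂ᴹ (GMT φ) (GMT ψ))))
  GMT-pers (φ ⇒̇ ψ) = □-pers (GMT φ ⊃ GMT ψ)

  □-curry : ∀ {φ ψ χ} → Persistent φ → ⊢ (φ ∧̇ ψ ⊃ χ) → ⊢ (φ ⊃ □̇ (ψ ⊃ χ))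
  □-curry p q = ⊃-trans p (□-mono (curry q))

  sound : ∀ {φ} → IPC φ → ⊢ GMT φ
  sound (⇒-K φ ψ) = nec-closed (□-curry (GMT-pers φ) (∧-E₁ᴹ (GMT φ) (GMT ψ)))
  sound (⇒-S φ ψ χ) = nec-closed (□-curry (□-pers _) (□-curry (∧-pers (□-pers _) (□-pers _))
    (ap (ap (⊃-trans (∧-E₁ᴹ _ C) (⊃-trans (∧-E₁ᴹ _ _)
              (⊃-trans (S4⊆ (T _)) (tt-⊃ (S4⊆ (T _))))))
            (∧-E₂ᴹ _ C))
        (ap (⊃-trans (∧-E₁ᴹ _ C) (⊃-trans (∧-E₂ᴹ _ _) (S4⊆ (T _))))
            (∧-E₂ᴹ _ C)))))
    where
    C : Modal
    C = GMT φ
    tt-⊃ : ∀ {α β γ} → ⊢ (α ⊃ β) → ⊢ ((γ ⊃ α) ⊃ (γ ⊃ β))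
    tt-⊃ {α} {β} {γ} p =
      curry (⊃-trans (uncurry (⊃-refl (γ ⊃ α))) p)
  sound (∧-I φ ψ) = nec-closed (□-curry (GMT-pers φ) (⊃-refl (GMT φ ∧̇ GMT ψ)))
  sound (∧-E₁ φ ψ) = nec-closed (∧-E₁ᴹ (GMT φ) (GMT ψ))
  sound (∧-E₂ φ ψ) = nec-closed (∧-E₂ᴹ (GMT φ) (GMT ψ))
  sound (∨-I₁ φ ψ) = nec-closed (∨-I₁ᴹ (GMT φ) (GMT ψ))
  sound (∨-I₂ φ ψ) = nec-closed (∨-I₂ᴹ (GMT φ) (GMT ψ))
  sound (∨-E φ ψ χ) = nec-closed (□-curry (□-pers _) (□-curry (∧-pers (□-pers _) (□-pers _))
    (uncurry (swap (cases
      (swap (⊃-trans (∧-E₁ᴹ _ _) (S4⊆ (T _))))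
      (swap (⊃-trans (∧-E₂ᴹ _ _) (S4⊆ (T _)))))))))
    where
    swap : ∀ {α β γ} → ⊢ (α ⊃ β ⊃ γ) → ⊢ (β ⊃ α ⊃ γ)
    swap {α} {β} p =
      curry (ap (⊃-trans (∧-E₂ᴹ β α) p) (∧-E₁ᴹ β α))
  sound ⊤-I = tt₀ λ v → refl
  sound (⊥-E φ) = nec-closed (efq (GMT φ))
  sound (mp {φ} {ψ} p q) = mp-closed (mp-closed (S4⊆ (T (GMT φ ⊃ GMT ψ))) (sound p)) (sound q)

  GMT-sub : ∀ s φ → ⊢ (GMT φ [ GMT ∘ s ] ⊃ GMT (φ [ s ]ⁱ)) ×
                    ⊢ (GMT (φ [ s ]ⁱ) ⊃ GMT φ [ GMT ∘ s ])
  GMT-sub s (var p) = S4⊆ (T (GMT (s p))) , GMT-pers (s p)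
  GMT-sub s ⊤̇       = ⊃-refl ⊤̇ , ⊃-refl ⊤̇
  GMT-sub s ⊥̇       = ⊃-refl ⊥̇ , ⊃-refl ⊥̇
  GMT-sub s (φ ∧̇ ψ) with GMT-sub s φ | GMT-sub s ψ
  ... | φ⇒ , φ⇐ | ψ⇒ , ψ⇐ = mono φ⇒ ψ⇒ , mono φ⇐ ψ⇐
    where
    mono : ∀ {α β γ δ} → ⊢ (α ⊃ β) → ⊢ (γ ⊃ δ) → ⊢ (α ∧̇ γ ⊃ β ∧̇ δ)
    mono {α} {β} {γ} p q = pair (⊃-trans (∧-E₁ᴹ α γ) p) (⊃-trans (∧-E₂ᴹ α γ) q)
  GMT-sub s (φ ∨̇ ψ) with GMT-sub s φ | GMT-sub s ψ
  ... | φ⇒ , φ⇐ | ψ⇒ , ψ⇐ = mono φ⇒ ψ⇒ , mono φ⇐ ψ⇐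
    where
    mono : ∀ {α β γ δ} → ⊢ (α ⊃ β) → ⊢ (γ ⊃ δ) → ⊢ (α ∨̇ γ ⊃ β ∨̇ δ)
    mono {α} {β} {γ} {δ} p q = cases (⊃-trans p (∨-I₁ᴹ β δ)) (⊃-trans q (∨-I₂ᴹ β δ))
  GMT-sub s (φ ⇒̇ ψ) with GMT-sub s φ | GMT-sub s ψ
  ... | φ⇒ , φ⇐ | ψ⇒ , ψ⇐ = □-mono (mono φ⇐ ψ⇒) , □-mono (mono φ⇒ ψ⇐)
    where
    mono : ∀ {α β γ δ} → ⊢ (α ⊃ β) → ⊢ (γ ⊃ δ) → ⊢ ((β ⊃ γ) ⊃ (α ⊃ δ))
    mono {α} {β} {γ} p q = curry (⊃-trans
      (ap (∧-E₁ᴹ (β ⊃ γ) α) (⊃-trans (∧-E₂ᴹ (β ⊃ γ) α) p)) q)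

ρ : NExtS4 m → ΛIPC m
ρ M = record
  { theorems   = λ φ → GMT φ ∈ thmᴹ M
  ; IPC⊆       = sound
  ; mp-closed  = λ p q → mp-closed (mp-closed (S4⊆ (T _)) p) q
  ; sub-closed = λ {φ} s p → mp-closed (proj₁ (GMT-sub s φ)) (sub-closed (GMT ∘ s) p)
  }
  where
  open NExtS4 M
  open GMT-sound M

IsModalCompanion : NExtS4 m → ΛIPC m → Set m
IsModalCompanion M L = ∀ φ → φ ∈ thmᴵ L ⇔ GMT φ ∈ thmᴹ M

IsGreatestModalCompanion : NExtS4 m → ΛIPC m → Set (lsuc m)
IsGreatestModalCompanion {m} M L =
  IsModalCompanion M L ×
  (∀ (S : NExtS4 m) → IsModalCompanion S L → thmᴹ S ⊆ thmᴹ M)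

------------------------------------------------------------------------
-- □-variants and schematic fragments

infix 11 _^□

_^□ : Pred Modal m → Pred Modal m
(L ^□) φ = φ [ (λ q → □̇ var q) ] ∈ L

Schem : Pred Modal m → Pred Modal m
Schem L φ = ∀ s → φ [ s ] ∈ L

□-maximal : NExtS4 m → Set (lsuc m)
□-maximal {m} L =
  ∀ (S : NExtS4 m) → thmᴹ L ^□ ≐ thmᴹ S ^□ → thmᴹ S ⊆ thmᴹ L

------------------------------------------------------------------------
-- S4-algebras

record S4Algebra ℓ : Set (lsuc ℓ) where
  field
    booleanAlgebra : BooleanAlgebra ℓ ℓ

  open BooleanAlgebra booleanAlgebra public
  open Poset (BooleanAlgebraProperties.poset booleanAlgebra) public
    using (_≤_)

  infix 8 □_
  field
    □_     : Carrier → Carrier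
    □-cong : Congruent _≈_ _≈_ □_
    □-⊤    : □ ⊤ ≈ ⊤
    □-∧    : ∀ a b → □ (a ∧ b) ≈ □ a ∧ □ b
    □-T    : ∀ a → □ a ≤ a
    □-4    : ∀ a → □ a ≤ □ □ a

  ⟦_⟧ : Modal → (ℕ → Carrier) → Carrier
  ⟦ var p ⟧ v = v p
  ⟦ ⊤̇ ⟧     v = ⊤
  ⟦ ⊥̇ ⟧     v = ⊥
  ⟦ ¬̇ φ ⟧   v = ¬ ⟦ φ ⟧ v
  ⟦ □̇ φ ⟧   v = □ ⟦ φ ⟧ v
  ⟦ φ ∧̇ ψ ⟧ v = ⟦ φ ⟧ v ∧ ⟦ ψ ⟧ v
  ⟦ φ ∨̇ ψ ⟧ v = ⟦ φ ⟧ v ∨ ⟦ ψ ⟧ v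

  ⊨_ : Modal → Set ℓ
  ⊨ φ = ∀ v → ⟦ φ ⟧ v ≈ ⊤

Log : Pred (S4Algebra ℓ) k → Pred Modal (lsuc ℓ ⊔ k)
Log C φ = ∀ A → A ∈ C → S4Algebra.⊨_ A φ

record IsHom (A B : S4Algebra ℓ)
             (f : S4Algebra.Carrier A → S4Algebra.Carrier B) : Set ℓ where
  private
    module A = S4Algebra A
    module B = S4Algebra B
  field
    f-cong : Congruent A._≈_ B._≈_ f
    f-⊤    : f A.⊤ B.≈ B.⊤
    f-⊥    : f A.⊥ B.≈ B.⊥
    f-¬    : ∀ a → f (A.¬ a) B.≈ B.¬ f a
    f-□    : ∀ a → f (A.□ a) B.≈ B.□ f a
    f-∧    : ∀ a b → f (a A.∧ b) B.≈ f a B.∧ f b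
    f-∨    : ∀ a b → f (a A.∨ b) B.≈ f a B.∨ f b

module _ (A B : S4Algebra ℓ) where
  private
    module A = S4Algebra A
    module B = S4Algebra B

  Embedding : Set ℓ
  Embedding = ∃[ f ] IsHom A B f × Injective A._≈_ B._≈_ f

  Surjection : Set ℓ
  Surjection = ∃[ f ] IsHom A B f × Surjective A._≈_ B._≈_ f

  Isomorphism : Set ℓ
  Isomorphism =
    ∃[ f ] IsHom A B f × Injective A._≈_ B._≈_ f × Surjective A._≈_ B._≈_ f

∏ : {I : Set ℓ} → (I → S4Algebra ℓ) → S4Algebra ℓ
∏ {ℓ} {I} A = record
  { booleanAlgebra = record
    { Carrier = ∀ i → A.Carrier i
    ; _≈_ = λ a b → ∀ i → A._≈_ i (a i) (b i)
    ; _∨_ = λ a b i → A._∨_ i (a i) (b i)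
    ; _∧_ = λ a b i → A._∧_ i (a i) (b i)
    ; ¬_  = λ a i → A.¬_ i (a i)
    ; ⊤   = λ i → A.⊤ i
    ; ⊥   = λ i → A.⊥ i
    ; isBooleanAlgebra = record
      { isDistributiveLattice = record
        { isLattice = record
          { isEquivalence = record
            { refl  = λ i → A.refl i
            ; sym   = λ p i → A.sym i (p i)
            ; trans = λ p q i → A.trans i (p i) (q i)
            }
          ; ∨-comm     = λ a b i → A.∨-comm i (a i) (b i)
          ; ∨-assoc    = λ a b c i → A.∨-assoc i (a i) (b i) (c i)
          ; ∨-cong     = λ p q i → A.∨-cong i (p i) (q i)
          ; ∧-comm     = λ a b i → A.∧-comm i (a i) (b i)
          ; ∧-assoc    = λ a b c i → A.∧-assoc i (a i) (b i) (c i)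
          ; ∧-cong     = λ p q i → A.∧-cong i (p i) (q i)
          ; absorptive = (λ a b i → A.∨-absorbs-∧ i (a i) (b i))
                       , (λ a b i → A.∧-absorbs-∨ i (a i) (b i))
          }
        ; ∨-distrib-∧ = (λ a b c i → A.∨-distribˡ-∧ i (a i) (b i) (c i))
                      , (λ a b c i → A.∨-distribʳ-∧ i (a i) (b i) (c i))
        ; ∧-distrib-∨ = (λ a b c i → A.∧-distribˡ-∨ i (a i) (b i) (c i))
                      , (λ a b c i → A.∧-distribʳ-∨ i (a i) (b i) (c i))
        }
      ; ∨-complement = (λ a i → A.∨-complementˡ i (a i))
                     , (λ a i → A.∨-complementʳ i (a i))
      ; ∧-complement = (λ a i → A.∧-complementˡ i (a i))
                     , (λ a i → A.∧-complementʳ i (a i))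
      ; ¬-cong = λ p i → A.¬-cong i (p i)
      }
    }
  ; □_     = λ a i → A.□_ i (a i)
  ; □-cong = λ p i → A.□-cong i (p i)
  ; □-⊤    = λ i → A.□-⊤ i
  ; □-∧    = λ a b i → A.□-∧ i (a i) (b i)
  ; □-T    = λ a i → A.□-T i (a i)
  ; □-4    = λ a i → A.□-4 i (a i)
  }
  where module A (i : I) = S4Algebra (A i)

-- The class operators return classes closed under isomorphism.

ℍ 𝕊 ℙ HSP : Pred (S4Algebra ℓ) k → Pred (S4Algebra ℓ) (lsuc ℓ ⊔ k)
ℍ C A = ∃[ B ] B ∈ C × Surjection B A
𝕊 C A = ∃[ B ] B ∈ C × Embedding A B
ℙ {ℓ} C A = Σ[ I ∈ Set ℓ ] Σ[ F ∈ (I → S4Algebra ℓ) ]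
            (∀ i → F i ∈ C) × Isomorphism A (∏ F)
HSP C = ℍ (𝕊 (ℙ C))

record Ξ-S4 ℓ k : Set (lsuc (ℓ ⊔ k)) where
  field
    members  : Pred (S4Algebra ℓ) k
    ℍ-closed : ℍ members ⊆ members
    𝕊-closed : 𝕊 members ⊆ members
    ℙ-closed : ℙ members ⊆ members

open Ξ-S4 using (members) public

------------------------------------------------------------------------
-- The Heyting algebra of open elements

HA : ∀ ℓ → Set (lsuc ℓ)
HA ℓ = HeytingAlgebra ℓ ℓ ℓ

module _ (B : S4Algebra ℓ) where
  open S4Algebra B
  open BooleanAlgebraProperties booleanAlgebra
    using (∨-∧-isOrderTheoreticLattice; poset; ∧-identityʳ; ∧-zeroˡ; ∨-identityˡ)
  private
    open import Relation.Binary.Lattice.Structures using (IsLattice)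
    module P = Poset poset
    module L = IsLattice ∨-∧-isOrderTheoreticLattice

    Open : Carrier → Set ℓ
    Open a = a ≈ □ a

    □-mono : ∀ {a b} → a ≤ b → □ a ≤ □ b
    □-mono a≤b = trans (□-cong a≤b) (□-∧ _ _)

    Open-intro : ∀ {a} → a ≤ □ a → Open a
    Open-intro p = P.antisym p (□-T _)

    □-open : ∀ a → Open (□ a)
    □-open a = Open-intro (□-4 a)

    ∧-open : ∀ {a b} → Open a → Open b → Open (a ∧ b)
    ∧-open p q = trans (∧-cong p q) (sym (□-∧ _ _))

    ∨-open : ∀ {a b} → Open a → Open b → Open (a ∨ b)
    ∨-open {a} {b} p q = Open-intro (L.∨-least
      (P.trans (P.reflexive p) (□-mono (L.x≤x∨y a b)))
      (P.trans (P.reflexive q) (□-mono (L.y≤x∨y a b))))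

    ≤-⊤ : ∀ a → a ≤ ⊤
    ≤-⊤ a = sym (∧-identityʳ a)

    ⊥-≤ : ∀ a → ⊥ ≤ a
    ⊥-≤ a = sym (∧-zeroˡ a)

    ⊃-intro : ∀ {w a b} → w ∧ a ≤ b → w ≤ ¬ a ∨ b
    ⊃-intro {w} {a} {b} p = P.trans (P.reflexive w≈) (L.∨-least
        (P.trans (L.x∧y≤y w (¬ a)) (L.x≤x∨y (¬ a) b))
        (P.trans p (L.y≤x∨y (¬ a) b)))
      where
      w≈ : w ≈ (w ∧ ¬ a) ∨ (w ∧ a)
      w≈ = trans (sym (∧-identityʳ w))
          (trans (∧-congˡ (sym (∨-complementˡ a))) (∧-distribˡ-∨ w (¬ a) a))

    ⊃-elim : ∀ {w a b} → w ≤ ¬ a ∨ b → w ∧ a ≤ b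
    ⊃-elim {w} {a} {b} p = P.trans
      (L.∧-greatest (P.trans (L.x∧y≤x w a) p) (L.x∧y≤y w a))
      (P.trans (P.reflexive (trans (∧-distribʳ-∨ a (¬ a) b)
                 (trans (∨-congʳ (∧-complementˡ a)) (∨-identityˡ (b ∧ a)))))
               (L.x∧y≤x b a))

  opens : HA ℓ
  opens = record
    { Carrier = Σ[ a ∈ Carrier ] a ≈ □ a
    ; _≈_ = λ a b → proj₁ a ≈ proj₁ b
    ; _≤_ = λ a b → proj₁ a ≤ proj₁ b
    ; _∨_ = λ (a , p) (b , q) → a ∨ b , ∨-open p q
    ; _∧_ = λ (a , p) (b , q) → a ∧ b , ∧-open p q
    ; _⇨_ = λ (a , _) (b , _) → □ (¬ a ∨ b) , □-open (¬ a ∨ b)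
    ; ⊤   = ⊤ , sym □-⊤
    ; ⊥   = ⊥ , Open-intro (⊥-≤ (□ ⊥))
    ; isHeytingAlgebra = record
      { isBoundedLattice = record
        { isLattice = record
          { isPartialOrder = record
            { isPreorder = record
              { isEquivalence = record { refl = S4Algebra.refl B ; sym = sym ; trans = trans }
              ; reflexive = P.reflexive
              ; trans = P.trans
              }
            ; antisym = P.antisym
            }
          ; supremum = λ (a , _) (b , _) →
              L.x≤x∨y a b , L.y≤x∨y a b , λ _ → L.∨-least
          ; infimum = λ (a , _) (b , _) →
              L.x∧y≤x a b , L.x∧y≤y a b , λ _ → L.∧-greatest
          }
        ; maximum = λ (a , _) → ≤-⊤ a
        ; minimum = λ (a , _) → ⊥-≤ a
        }
      ; exponential = λ (w , w-open) (a , _) (b , _) →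
            (λ p → P.trans (P.reflexive w-open) (□-mono (⊃-intro p)))
          , (λ p → ⊃-elim (P.trans p (□-T (¬ a ∨ b))))
      }
    }

record HeytingIso (G H : HA ℓ) : Set ℓ where
  private
    module G = HeytingAlgebra G
    module H = HeytingAlgebra H
  field
    to         : G.Carrier → H.Carrier
    to-cong    : Congruent G._≈_ H._≈_ to
    injective  : Injective G._≈_ H._≈_ to
    surjective : Surjective G._≈_ H._≈_ to
    to-⊤       : to G.⊤ H.≈ H.⊤
    to-⊥       : to G.⊥ H.≈ H.⊥
    to-∧       : ∀ a b → to (a G.∧ b) H.≈ to a H.∧ to b
    to-∨       : ∀ a b → to (a G.∨ b) H.≈ to a H.∨ to b
    to-⇨       : ∀ a b → to (a G.⇨ b) H.≈ to a H.⇨ to b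

-- Algebras are compared up to isomorphism, never by propositional equality.
ρᵃ : Pred (S4Algebra ℓ) k → Pred (HA ℓ) (lsuc ℓ ⊔ k)
ρᵃ C H = ∃[ B ] B ∈ C × HeytingIso (opens B) H

------------------------------------------------------------------------
-- Boolean envelopes

record PrimeFilter (H : HA ℓ) : Set (lsuc ℓ) where
  open HeytingAlgebra H
  field
    member   : Pred Carrier ℓ
    upward   : ∀ {a b} → a ≤ b → a ∈ member → b ∈ member
    ∧-closed : ∀ {a b} → a ∈ member → b ∈ member → a ∧ b ∈ member
    ⊤-member : ⊤ ∈ member
    proper   : Not (⊥ ∈ member)
    prime    : ∀ {a b} → a ∨ b ∈ member → a ∈ member ⊎ b ∈ member

data Generated (B : BooleanAlgebra ℓ ℓ) {I : Set ℓ}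
               (ι : I → BooleanAlgebra.Carrier B) :
               BooleanAlgebra.Carrier B → Set ℓ where
  gen  : ∀ i → Generated B ι (ι i)
  ⊤-cl : Generated B ι (BooleanAlgebra.⊤ B)
  ⊥-cl : Generated B ι (BooleanAlgebra.⊥ B)
  ¬-cl : ∀ {a} → Generated B ι a → Generated B ι (BooleanAlgebra.¬_ B a)
  ∧-cl : ∀ {a b} → Generated B ι a → Generated B ι b →
         Generated B ι (BooleanAlgebra._∧_ B a b)
  ∨-cl : ∀ {a b} → Generated B ι a → Generated B ι b →
         Generated B ι (BooleanAlgebra._∨_ B a b)
  ≈-cl : ∀ {a b} → BooleanAlgebra._≈_ B a b →
         Generated B ι a → Generated B ι b

-- "A is B(H)": ext identifies the Boolean reduct of A with a Boolean
-- algebra of sets of prime filters of H, namely the one generated by the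
-- sets {x ∣ a ∈ x}, and □ is given by the stated formula.  This determines
-- A up to isomorphism, since every Boolean combination of elements of H is
-- a finite meet of elements ¬ c ∨ d.  A relation rather than a function on
-- Heyting algebras is used because □ is well defined on B(H) only by the
-- prime filter theorem, which is a choice principle.
record IsBooleanEnvelope (H : HA ℓ) (A : S4Algebra ℓ) : Set (lsuc ℓ) where
  private
    module H = HeytingAlgebra H
    module A = S4Algebra A
  field
    ext     : A.Carrier → Pred (PrimeFilter H) ℓ
    ext-≈   : ∀ a b → a A.≈ b ⇔ ext a ≐ ext b
    ext-⊤   : ext A.⊤ ≐ U
    ext-⊥   : ext A.⊥ ≐ ∅
    ext-¬   : ∀ a → ext (A.¬ a) ≐ ∁ (ext a)
    ext-∧   : ∀ a b → ext (a A.∧ b) ≐ ext a ∩ ext b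
    ext-∨   : ∀ a b → ext (a A.∨ b) ≐ ext a ∪ ext b

    ι         : H.Carrier → A.Carrier
    ext-ι     : ∀ c → ext (ι c) ≐ (λ x → c ∈ PrimeFilter.member x)
    generated : ∀ a → Generated A.booleanAlgebra ι a

    □-meet : ∀ (cds : List (H.Carrier × H.Carrier)) →
             A.□ foldr A._∧_ A.⊤ (map (λ (c , d) → A.¬ ι c A.∨ ι d) cds)
               A.≈
             ι (foldr H._∧_ H.⊤ (map (λ (c , d) → c H.⇨ d) cds))

σ : Pred (HA ℓ) k → Pred (S4Algebra ℓ) (lsuc ℓ ⊔ k)
σ P = HSP (λ A → ∃[ H ] H ∈ P × IsBooleanEnvelope H A)

{-# OPTIONS --safe #-}
module Submission where

-- The whole argument rests on one fact about open elements.  A Boolean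
-- combination of open elements of an S4-algebra is a finite meet of clauses
-- ¬ c ∨ d with c and d open, and the box of such a meet is the meet of the
-- Heyting implications from c to d.  So for each modal formula φ there is an
-- intuitionistic formula, interior φ, whose translation has in every
-- S4-algebra the same value as the box of φ[□p] (□-interior).
--
-- For logics, read this in the Lindenbaum algebra of M: φ belongs to the
-- □-variant of M exactly when interior φ belongs to ρ M.  Conversely, GMT φ
-- is unchanged by boxing its letters, so φ belongs to ρ M exactly when GMT φ
-- belongs to the □-variant.  Hence ρ M and the □-variant of M determine each
-- other, the modal companions of ρ L are the logics with the □-variant of L
-- (companion⇔□-variant), and □-maximality is being greatest among them.
--
-- For varieties, passing to HSP does not change the logic, so Log (σ (ρ K))
-- is the logic of the Boolean envelopes A of the algebras of opens of members
-- B of K.  If all □-instances of φ are valid in K, then φ holds in A: every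
-- element of A is the value of a modal formula at open elements, and validity
-- at open elements depends only on the Heyting algebra of opens, so it
-- transfers from B to A (⊨-transfer).
--
-- For the converse, the Boolean hull of the opens of B should be an
-- envelope.  Knowing this requires enough prime filters, which excluded
-- middle alone does not provide for arbitrary algebras.  A single valuation
-- in B, however, only involves the countable subalgebra it generates, again a
-- member of K, and in a countable Boolean algebra an ultrafilter containing a
-- given nonzero element is built one step at a time (CountableUltrafilter).
-- Inside that subalgebra the hull is an envelope (hull-isEnvelope); it
-- validates φ, hence φ[s], and the value of φ[s] at boxed arguments is the
-- same in the hull and in B.

open import Defs
open import Algebra.Bundles using (CommutativeSemiring)
open import Algebra.Lattice.Bundles using (BooleanAlgebra)
import Algebra.Lattice.Properties.BooleanAlgebra as BooleanAlgebraProperties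
import Algebra.Lattice.Structures.Biased as Biased
import Algebra.Properties.CommutativeSemigroup as CommutativeSemigroupProperties
open import Axiom.ExcludedMiddle using (ExcludedMiddle)
open import Data.Bool.Base using (true; false; not) renaming (_∨_ to _||_)
import Data.Bool.Properties as Bool
open import Data.Empty using (⊥-elim)
open import Data.List.Base using (List; []; _∷_; _++_; map; foldr; cartesianProductWith)
open import Data.Nat.Base using (ℕ; zero; suc; _+_; _⊔_; s≤s) renaming (_≤_ to _≤ⁿ_)
open import Data.Nat.Properties
  using (+-comm; +-identityʳ; +-suc; m⊔n≤o⇒m≤o; m⊔n≤o⇒n≤o)
  renaming (≤-refl to ≤ⁿ-refl)
open import Data.Product.Base using (∃; ∃-syntax; _×_; _,_; proj₁; proj₂)
open import Data.Sum.Base as Sum using (_⊎_; inj₁; inj₂)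
open import Data.Unit.Base using () renaming (⊤ to ⊤′)
open import Function.Base using (_∘_)
open import Function.Bundles using (_⇔_; mk⇔; module Equivalence)
open import Function.Definitions using (Congruent; Injective; Surjective)
open import Level using (Level; Lift; lift)
open import Relation.Binary.Bundles using (Poset)
open import Relation.Binary.Lattice.Bundles using (HeytingAlgebra)
open import Relation.Binary.Lattice.Structures using (IsLattice)
open import Relation.Binary.PropositionalEquality as ≡ using (_≡_)
import Relation.Binary.Reasoning.Setoid as SetoidReasoning
open import Relation.Nullary.Decidable.Core using (Dec; yes; no; decidable-stable)
open import Relation.Nullary.Negation.Core using () renaming (¬_ to Not_)
open import Relation.Unary using (Pred; _∈_; _⊆_; _≐_)

open Equivalence using (to; from)

private
  variable
    ℓ k m : Level

-- Evaluation in an S4-algebra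

module Evaluation (A : S4Algebra ℓ) where
  open S4Algebra A

  ⟦⟧-cong : ∀ φ {v w} → (∀ p → v p ≈ w p) → ⟦ φ ⟧ v ≈ ⟦ φ ⟧ w
  ⟦⟧-cong (var p) e = e p
  ⟦⟧-cong ⊤̇       e = refl
  ⟦⟧-cong ⊥̇       e = refl
  ⟦⟧-cong (¬̇ φ)   e = ¬-cong (⟦⟧-cong φ e)
  ⟦⟧-cong (□̇ φ)   e = □-cong (⟦⟧-cong φ e)
  ⟦⟧-cong (φ ∧̇ ψ) e = ∧-cong (⟦⟧-cong φ e) (⟦⟧-cong ψ e)
  ⟦⟧-cong (φ ∨̇ ψ) e = ∨-cong (⟦⟧-cong φ e) (⟦⟧-cong ψ e)

  ⟦⟧-[] : ∀ φ s {v} → ⟦ φ [ s ] ⟧ v ≡ ⟦ φ ⟧ (λ p → ⟦ s p ⟧ v)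
  ⟦⟧-[] (var p) s = ≡.refl
  ⟦⟧-[] ⊤̇       s = ≡.refl
  ⟦⟧-[] ⊥̇       s = ≡.refl
  ⟦⟧-[] (¬̇ φ)   s = ≡.cong ¬_ (⟦⟧-[] φ s)
  ⟦⟧-[] (□̇ φ)   s = ≡.cong □_ (⟦⟧-[] φ s)
  ⟦⟧-[] (φ ∧̇ ψ) s = ≡.cong₂ _∧_ (⟦⟧-[] φ s) (⟦⟧-[] ψ s)
  ⟦⟧-[] (φ ∨̇ ψ) s = ≡.cong₂ _∨_ (⟦⟧-[] φ s) (⟦⟧-[] ψ s)

  □-idem : ∀ a → □ □ a ≈ □ a
  □-idem a = trans (□-T (□ a)) (trans (∧-comm _ _) (sym (□-4 a)))

  □-≈⊤ : ∀ {a} → □ a ≈ ⊤ ⇔ a ≈ ⊤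
  □-≈⊤ {a} = mk⇔
    (λ e → trans (sym (trans (∧-congʳ e) (∧-identityˡ a)))
                 (trans (sym (□-T a)) e))
    (λ e → trans (□-cong e) □-⊤)
    where open BooleanAlgebraProperties booleanAlgebra using (∧-identityˡ)

  -- The translation boxes every letter, and boxing twice changes nothing.
  GMT-□ : ∀ φ v → ⟦ GMT φ ⟧ (□_ ∘ v) ≈ ⟦ GMT φ ⟧ v
  GMT-□ (var p) v = □-idem (v p)
  GMT-□ ⊤̇       v = refl
  GMT-□ ⊥̇       v = refl
  GMT-□ (φ ∧̇ ψ) v = ∧-cong (GMT-□ φ v) (GMT-□ ψ v)
  GMT-□ (φ ∨̇ ψ) v = ∨-cong (GMT-□ φ v) (GMT-□ ψ v)
  GMT-□ (φ ⇒̇ ψ) v = □-cong (∨-cong (¬-cong (GMT-□ φ v)) (GMT-□ ψ v))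

-- Clausal normal forms over translated formulas

-- The pair (c , d) stands for the modal formula GMT c ⊃ GMT d.
Clause : Set
Clause = Int × Int

-- A disjunction of two clauses is again one:
-- (¬ c ∨ d) ∨ (¬ c′ ∨ d′) = ¬ (c ∧ c′) ∨ (d ∨ d′).
_∨ᶜ_ : Clause → Clause → Clause
(c , d) ∨ᶜ (c′ , d′) = (c ∧̇ c′) , (d ∨̇ d′)

_∨ᶜˢ_ : List Clause → List Clause → List Clause
_∨ᶜˢ_ = cartesianProductWith _∨ᶜ_

-- The negation of a clause (c , d) is c ∧ ¬ d, the meet of the clauses
-- (⊤ , c) and (d , ⊥).
¬ᶜˢ_ : List Clause → List Clause
¬ᶜˢ []             = (⊤̇ , ⊥̇) ∷ []
¬ᶜˢ ((c , d) ∷ cs) = ((⊤̇ , c) ∷ (d , ⊥̇) ∷ []) ∨ᶜˢ (¬ᶜˢ cs)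

implications : List Clause → Int
implications = foldr _∧̇_ ⊤̇ ∘ map (λ (c , d) → c ⇒̇ d)

-- Clauses for φ[□p].  Every letter, and every box by the induction, is a
-- single open element, and hence a clause with antecedent ⊤.
clauses : Modal → List Clause
clauses (var p) = (⊤̇ , var p) ∷ []
clauses ⊤̇       = []
clauses ⊥̇       = (⊤̇ , ⊥̇) ∷ []
clauses (¬̇ φ)   = ¬ᶜˢ clauses φ
clauses (□̇ φ)   = (⊤̇ , implications (clauses φ)) ∷ []
clauses (φ ∧̇ ψ) = clauses φ ++ clauses ψ
clauses (φ ∨̇ ψ) = clauses φ ∨ᶜˢ clauses ψ

-- The largest open element below the value of a modal formula at open
-- arguments, written intuitionistically.
interior : Modal → Int
interior = implications ∘ clauses

module ClausalForm (A : S4Algebra ℓ) (v : ℕ → S4Algebra.Carrier A) where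
  open S4Algebra A
  open BooleanAlgebraProperties booleanAlgebra
  open SetoidReasoning setoid
  open CommutativeSemigroupProperties
    (CommutativeSemiring.+-commutativeSemigroup ∨-∧-commutativeSemiring)
    using (interchange)

  private
    g : Int → Carrier
    g c = ⟦ GMT c ⟧ v

  ⟦_⟧ᶜ : Clause → Carrier
  ⟦ c , d ⟧ᶜ = ¬ g c ∨ g d

  ⋀ : List Clause → Carrier
  ⋀ []       = ⊤
  ⋀ (x ∷ xs) = ⟦ x ⟧ᶜ ∧ ⋀ xs

  ⊤-clause : ∀ d → ⋀ ((⊤̇ , d) ∷ []) ≈ g d
  ⊤-clause d = begin
    (¬ ⊤ ∨ g d) ∧ ⊤ ≈⟨ ∧-identityʳ _ ⟩
    ¬ ⊤ ∨ g d       ≈⟨ ∨-congʳ ¬⊤≈⊥ ⟩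
    ⊥ ∨ g d         ≈⟨ ∨-identityˡ _ ⟩
    g d             ∎

  ⊥-clause : ∀ c → ⋀ ((c , ⊥̇) ∷ []) ≈ ¬ g c
  ⊥-clause c = trans (∧-identityʳ _) (∨-identityʳ _)

  ⋀-++ : ∀ xs ys → ⋀ (xs ++ ys) ≈ ⋀ xs ∧ ⋀ ys
  ⋀-++ []       ys = sym (∧-identityˡ _)
  ⋀-++ (x ∷ xs) ys = trans (∧-congˡ (⋀-++ xs ys)) (sym (∧-assoc _ _ _))

  ⟦⟧ᶜ-∨ : ∀ x y → ⟦ x ∨ᶜ y ⟧ᶜ ≈ ⟦ x ⟧ᶜ ∨ ⟦ y ⟧ᶜ
  ⟦⟧ᶜ-∨ (c , d) (c′ , d′) =
    trans (∨-congʳ (deMorgan₁ (g c) (g c′)))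
          (interchange (¬ g c) (¬ g c′) (g d) (g d′))

  ⋀-map-∨ : ∀ x ys → ⋀ (map (x ∨ᶜ_) ys) ≈ ⟦ x ⟧ᶜ ∨ ⋀ ys
  ⋀-map-∨ x []       = sym (∨-zeroʳ _)
  ⋀-map-∨ x (y ∷ ys) = trans (∧-cong (⟦⟧ᶜ-∨ x y) (⋀-map-∨ x ys))
                             (sym (∨-distribˡ-∧ _ _ _))

  ⋀-∨ : ∀ xs ys → ⋀ (xs ∨ᶜˢ ys) ≈ ⋀ xs ∨ ⋀ ys
  ⋀-∨ []       ys = sym (∨-zeroˡ _)
  ⋀-∨ (x ∷ xs) ys = begin
    ⋀ (map (x ∨ᶜ_) ys ++ (xs ∨ᶜˢ ys))    ≈⟨ ⋀-++ (map (x ∨ᶜ_) ys) _ ⟩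
    ⋀ (map (x ∨ᶜ_) ys) ∧ ⋀ (xs ∨ᶜˢ ys)   ≈⟨ ∧-cong (⋀-map-∨ x ys) (⋀-∨ xs ys) ⟩
    (⟦ x ⟧ᶜ ∨ ⋀ ys) ∧ (⋀ xs ∨ ⋀ ys)      ≈⟨ ∨-distribʳ-∧ _ _ _ ⟨
    (⟦ x ⟧ᶜ ∧ ⋀ xs) ∨ ⋀ ys               ∎

  ⋀-¬ : ∀ xs → ⋀ (¬ᶜˢ xs) ≈ ¬ ⋀ xs
  ⋀-¬ []             = trans (⊤-clause ⊥̇) (sym ¬⊤≈⊥)
  ⋀-¬ ((c , d) ∷ xs) = begin
    ⋀ (((⊤̇ , c) ∷ (d , ⊥̇) ∷ []) ∨ᶜˢ (¬ᶜˢ xs))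
      ≈⟨ ⋀-∨ ((⊤̇ , c) ∷ (d , ⊥̇) ∷ []) (¬ᶜˢ xs) ⟩
    ⋀ ((⊤̇ , c) ∷ (d , ⊥̇) ∷ []) ∨ ⋀ (¬ᶜˢ xs)
      ≈⟨ ∨-cong (⋀-++ ((⊤̇ , c) ∷ []) ((d , ⊥̇) ∷ [])) (⋀-¬ xs) ⟩
    (⋀ ((⊤̇ , c) ∷ []) ∧ ⋀ ((d , ⊥̇) ∷ [])) ∨ ¬ ⋀ xs
      ≈⟨ ∨-congʳ (∧-cong (⊤-clause c) (⊥-clause d)) ⟩
    (g c ∧ ¬ g d) ∨ ¬ ⋀ xs
      ≈⟨ ∨-congʳ (∧-congʳ (¬-involutive (g c))) ⟨
    (¬ ¬ g c ∧ ¬ g d) ∨ ¬ ⋀ xs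
      ≈⟨ ∨-congʳ (deMorgan₂ (¬ g c) (g d)) ⟨
    ¬ (¬ g c ∨ g d) ∨ ¬ ⋀ xs
      ≈⟨ deMorgan₁ _ _ ⟨
    ¬ ((¬ g c ∨ g d) ∧ ⋀ xs) ∎

  -- Box commutes with finite meets, and the translation of c ⇒̇ d is the
  -- box of the clause (c , d).
  □-⋀ : ∀ xs → □ ⋀ xs ≈ g (implications xs)
  □-⋀ []       = □-⊤
  □-⋀ (x ∷ xs) = trans (□-∧ _ _) (∧-congˡ (□-⋀ xs))

  ⟦⟧-clauses : ∀ φ → ⟦ φ ⟧ (□_ ∘ v) ≈ ⋀ (clauses φ)
  ⟦⟧-clauses (var p) = sym (⊤-clause (var p))
  ⟦⟧-clauses ⊤̇       = refl
  ⟦⟧-clauses ⊥̇       = sym (⊤-clause ⊥̇)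
  ⟦⟧-clauses (¬̇ φ)   = trans (¬-cong (⟦⟧-clauses φ)) (sym (⋀-¬ (clauses φ)))
  ⟦⟧-clauses (□̇ φ)   = begin
    □ ⟦ φ ⟧ (□_ ∘ v)                    ≈⟨ □-cong (⟦⟧-clauses φ) ⟩
    □ ⋀ (clauses φ)                     ≈⟨ □-⋀ (clauses φ) ⟩
    g (implications (clauses φ))        ≈⟨ ⊤-clause (implications (clauses φ)) ⟨
    ⋀ ((⊤̇ , implications (clauses φ)) ∷ []) ∎
  ⟦⟧-clauses (φ ∧̇ ψ) = trans (∧-cong (⟦⟧-clauses φ) (⟦⟧-clauses ψ))
                             (sym (⋀-++ (clauses φ) (clauses ψ)))
  ⟦⟧-clauses (φ ∨̇ ψ) = trans (∨-cong (⟦⟧-clauses φ) (⟦⟧-clauses ψ))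
                             (sym (⋀-∨ (clauses φ) (clauses ψ)))

  □-interior : ∀ φ → □ ⟦ φ ⟧ (□_ ∘ v) ≈ ⟦ GMT (interior φ) ⟧ v
  □-interior φ = trans (□-cong (⟦⟧-clauses φ)) (□-⋀ (clauses φ))

  -- Since □ a is ⊤ only if a is ⊤, the box in □-interior does not affect
  -- validity.
  valid⇔interior : ∀ φ → ⟦ φ ⟧ (□_ ∘ v) ≈ ⊤ ⇔ ⟦ GMT (interior φ) ⟧ v ≈ ⊤
  valid⇔interior φ = mk⇔
    (λ e → trans (sym (□-interior φ)) (from □-≈⊤ e))
    (λ e → to □-≈⊤ (trans (□-interior φ) e))
    where open Evaluation A

-- The Lindenbaum algebra of a modal logic

module Lindenbaum (M : NExtS4 m) where
  open NExtS4 M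
  open GMT-sound M using (⊢_; tt₀; tt₁; ⊃-refl; ⊃-trans; ∧-E₁ᴹ; ∧-E₂ᴹ; pair;
                          ∨-I₁ᴹ; ∨-I₂ᴹ; cases; curry; uncurry; const; □-mono)

  infix 4 _≃_
  _≃_ : Modal → Modal → Set _
  φ ≃ ψ = ⊢ (φ ⊃ ψ) × ⊢ (ψ ⊃ φ)

  -- Every classical law is inherited from the two-element Boolean algebra.
  truth⇒≃ : ∀ {φ ψ} → (∀ v → truth v φ ≡ truth v ψ) → φ ≃ ψ
  truth⇒≃ e = tt₀ (λ v → implied (e v)) , tt₀ (λ v → implied (≡.sym (e v)))
    where
    implied : ∀ {a b} → a ≡ b → not a || b ≡ true
    implied {a} ≡.refl = Bool.∨-inverseˡ a

  contrapose : ∀ {φ ψ} → ⊢ (φ ⊃ ψ) → ⊢ (¬̇ ψ ⊃ ¬̇ φ)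
  contrapose {φ} {ψ} = tt₁ λ v → go (truth v φ) (truth v ψ)
    where
    go : ∀ a b → not (not a || b) || (not (not b) || not a) ≡ true
    go true  true  = ≡.refl
    go true  false = ≡.refl
    go false true  = ≡.refl
    go false false = ≡.refl

  ∧-mono : ∀ {φ φ′ ψ ψ′} → ⊢ (φ ⊃ φ′) → ⊢ (ψ ⊃ ψ′) → ⊢ (φ ∧̇ ψ ⊃ φ′ ∧̇ ψ′)
  ∧-mono p q = pair (⊃-trans (∧-E₁ᴹ _ _) p) (⊃-trans (∧-E₂ᴹ _ _) q)

  ∨-mono : ∀ {φ φ′ ψ ψ′} → ⊢ (φ ⊃ φ′) → ⊢ (ψ ⊃ ψ′) → ⊢ (φ ∨̇ ψ ⊃ φ′ ∨̇ ψ′)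
  ∨-mono p q = cases (⊃-trans p (∨-I₁ᴹ _ _)) (⊃-trans q (∨-I₂ᴹ _ _))

  ⊃⇒≃∧ : ∀ {φ ψ} → ⊢ (φ ⊃ ψ) → φ ≃ φ ∧̇ ψ
  ⊃⇒≃∧ p = pair (⊃-refl _) p , ∧-E₁ᴹ _ _

  -- For the converse direction ψ ⊃ φ ∧̇ ψ is boxed under the assumption □̇ φ, and
  -- axiom K distributes the box.
  □-∧-≃ : ∀ φ ψ → □̇ (φ ∧̇ ψ) ≃ □̇ φ ∧̇ □̇ ψ
  □-∧-≃ φ ψ =
      pair (□-mono (∧-E₁ᴹ φ ψ)) (□-mono (∧-E₂ᴹ φ ψ))
    , uncurry (⊃-trans (□-mono (curry (⊃-refl (φ ∧̇ ψ)))) (S4⊆ (K ψ (φ ∧̇ ψ))))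

  algebra : S4Algebra m
  algebra = record
    { booleanAlgebra = record
      { Carrier = Lift m Modal
      ; _≈_ = λ (lift φ) (lift ψ) → φ ≃ ψ
      ; _∨_ = λ (lift φ) (lift ψ) → lift (φ ∨̇ ψ)
      ; _∧_ = λ (lift φ) (lift ψ) → lift (φ ∧̇ ψ)
      ; ¬_  = λ (lift φ) → lift (¬̇ φ)
      ; ⊤   = lift ⊤̇
      ; ⊥   = lift ⊥̇
      ; isBooleanAlgebra = Biased.isBooleanAlgebraʳ record
        { isDistributiveLattice = Biased.isDistributiveLatticeʳʲᵐ record
          { isLattice = record
            { isEquivalence = record
              { refl  = ⊃-refl _ , ⊃-refl _
              ; sym   = λ (p , q) → q , p
              ; trans = λ (p , p′) (q , q′) → ⊃-trans p q , ⊃-trans q′ p′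
              }
            ; ∨-comm     = λ (lift φ) (lift ψ) → truth⇒≃ λ v → Bool.∨-comm (truth v φ) (truth v ψ)
            ; ∨-assoc    = λ (lift φ) _ _ → truth⇒≃ λ v → Bool.∨-assoc (truth v φ) _ _
            ; ∨-cong     = λ (p , p′) (q , q′) → ∨-mono p q , ∨-mono p′ q′
            ; ∧-comm     = λ (lift φ) (lift ψ) → truth⇒≃ λ v → Bool.∧-comm (truth v φ) (truth v ψ)
            ; ∧-assoc    = λ (lift φ) _ _ → truth⇒≃ λ v → Bool.∧-assoc (truth v φ) _ _
            ; ∧-cong     = λ (p , p′) (q , q′) → ∧-mono p q , ∧-mono p′ q′
            ; absorptive =
                (λ (lift φ) (lift ψ) → truth⇒≃ λ v → Bool.∨-abs-∧ (truth v φ) (truth v ψ))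
              , (λ (lift φ) (lift ψ) → truth⇒≃ λ v → Bool.∧-abs-∨ (truth v φ) (truth v ψ))
            }
          ; ∨-distribʳ-∧ = λ (lift φ) (lift ψ) (lift χ) → truth⇒≃ λ v →
              Bool.∨-distribʳ-∧ (truth v φ) (truth v ψ) (truth v χ)
          }
        ; ∨-complementʳ = λ (lift φ) → truth⇒≃ λ v → Bool.∨-inverseʳ (truth v φ)
        ; ∧-complementʳ = λ (lift φ) → truth⇒≃ λ v → Bool.∧-inverseʳ (truth v φ)
        ; ¬-cong = λ (p , q) → contrapose q , contrapose p
        }
      }
    ; □_     = λ (lift φ) → lift (□̇ φ)
    ; □-cong = λ (p , q) → □-mono p , □-mono q
    ; □-⊤    = const _ ⊢⊤ , const _ (nec-closed ⊢⊤)
    ; □-∧    = λ (lift φ) (lift ψ) → □-∧-≃ φ ψ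
    ; □-T    = λ (lift φ) → ⊃⇒≃∧ (S4⊆ (T φ))
    ; □-4    = λ (lift φ) → ⊃⇒≃∧ (S4⊆ (4′ φ))
    }
    where
    ⊢⊤ : ⊢ ⊤̇
    ⊢⊤ = tt₀ λ _ → ≡.refl

  open S4Algebra algebra using (⟦_⟧; _≈_; ⊤)

  -- Under the canonical valuation every formula denotes its own class, so a
  -- logic is the set of formulas with value ⊤ here.
  ⟦⟧-var : ∀ φ → ⟦ φ ⟧ (lift ∘ var) ≡ lift φ
  ⟦⟧-var (var p) = ≡.refl
  ⟦⟧-var ⊤̇       = ≡.refl
  ⟦⟧-var ⊥̇       = ≡.refl
  ⟦⟧-var (¬̇ φ)   = ≡.cong (S4Algebra.¬_ algebra) (⟦⟧-var φ)
  ⟦⟧-var (□̇ φ)   = ≡.cong (S4Algebra.□_ algebra) (⟦⟧-var φ)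
  ⟦⟧-var (φ ∧̇ ψ) = ≡.cong₂ (S4Algebra._∧_ algebra) (⟦⟧-var φ) (⟦⟧-var ψ)
  ⟦⟧-var (φ ∨̇ ψ) = ≡.cong₂ (S4Algebra._∨_ algebra) (⟦⟧-var φ) (⟦⟧-var ψ)

  ⊢⇔≈⊤ : ∀ φ → φ ∈ theorems ⇔ ⟦ φ ⟧ (lift ∘ var) ≈ ⊤
  ⊢⇔≈⊤ φ rewrite ⟦⟧-var φ = mk⇔
    (λ p → const φ (tt₀ λ _ → ≡.refl) , const ⊤̇ p)
    (λ (_ , q) → mp-closed q (tt₀ λ _ → ≡.refl))

  open Evaluation algebra

  □-variant⇔≈⊤ : ∀ φ → φ ∈ theorems ^□ ⇔ ⟦ φ ⟧ (lift ∘ □̇_ ∘ var) ≈ ⊤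
  □-variant⇔≈⊤ φ = mk⇔
    (λ p → ≡.subst (_≈ ⊤) (⟦⟧-[] φ _) (to (⊢⇔≈⊤ (φ [ □̇_ ∘ var ])) p))
    (λ e → from (⊢⇔≈⊤ (φ [ □̇_ ∘ var ])) (≡.subst (_≈ ⊤) (≡.sym (⟦⟧-[] φ _)) e))

  -- The identity for the interior, read in the Lindenbaum algebra: membership
  -- in the □-variant is a question about ρ M.
  □-variant⇔interior : ∀ φ → φ ∈ theorems ^□ ⇔ interior φ ∈ thmᴵ (ρ M)
  □-variant⇔interior φ = mk⇔
    (λ p → from (⊢⇔≈⊤ (GMT (interior φ)))
             (to (valid⇔interior φ) (to (□-variant⇔≈⊤ φ) p)))
    (λ p → from (□-variant⇔≈⊤ φ)
             (from (valid⇔interior φ) (to (⊢⇔≈⊤ (GMT (interior φ))) p)))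
    where open ClausalForm algebra (lift ∘ var) using (valid⇔interior)

  GMT⇔□-variant : ∀ φ → φ ∈ thmᴵ (ρ M) ⇔ GMT φ ∈ theorems ^□
  GMT⇔□-variant φ = mk⇔
    (λ p → from (□-variant⇔≈⊤ (GMT φ))
             (trans (GMT-□ φ (lift ∘ var)) (to (⊢⇔≈⊤ (GMT φ)) p)))
    (λ p → from (⊢⇔≈⊤ (GMT φ))
             (trans (sym (GMT-□ φ (lift ∘ var))) (to (□-variant⇔≈⊤ (GMT φ)) p)))
    where
    open S4Algebra algebra using (trans; sym)

-- Modal companions and □-variants

-- Being a companion of ρ L means having the same ρ as L, and □-variants and
-- ρ are interdefinable uniformly in the logic, through interior and GMT.
companion⇔□-variant : (L S : NExtS4 m) →
  IsModalCompanion S (ρ L) ⇔ (thmᴹ L ^□ ≐ thmᴹ S ^□)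
companion⇔□-variant L S = mk⇔
  (λ c → (λ {φ} p → from (S.□-variant⇔interior φ)
                      (to (c (interior φ)) (to (L.□-variant⇔interior φ) p)))
       , (λ {φ} p → from (L.□-variant⇔interior φ)
                      (from (c (interior φ)) (to (S.□-variant⇔interior φ) p))))
  (λ (L⊆S , S⊆L) φ → mk⇔
    (λ p → from (S.GMT⇔□-variant φ) (L⊆S {GMT φ} (to (L.GMT⇔□-variant φ) p)))
    (λ p → from (L.GMT⇔□-variant φ) (S⊆L {GMT φ} (to (S.GMT⇔□-variant φ) p))))
  where
  module L = Lindenbaum L
  module S = Lindenbaum S

□-maximal⇔greatest : (L : NExtS4 m) →
  □-maximal L ⇔ IsGreatestModalCompanion L (ρ L)
□-maximal⇔greatest L = mk⇔
  (λ max → (λ _ → mk⇔ (λ p → p) (λ p → p))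
         , λ S c → max S (to (companion⇔□-variant L S) c))
  (λ (_ , greatest) S e → greatest S (from (companion⇔□-variant L S) e))

-- Validity and the class operators

module _ {A B : S4Algebra ℓ} {f : S4Algebra.Carrier A → S4Algebra.Carrier B}
         (h : IsHom A B f) where
  private
    module A = S4Algebra A
    module B = S4Algebra B
  open IsHom h

  hom-⟦⟧ : ∀ φ v → f (A.⟦ φ ⟧ v) B.≈ B.⟦ φ ⟧ (f ∘ v)
  hom-⟦⟧ (var p) v = B.refl
  hom-⟦⟧ ⊤̇       v = f-⊤
  hom-⟦⟧ ⊥̇       v = f-⊥
  hom-⟦⟧ (¬̇ φ)   v = B.trans (f-¬ _) (B.¬-cong (hom-⟦⟧ φ v))
  hom-⟦⟧ (□̇ φ)   v = B.trans (f-□ _) (B.□-cong (hom-⟦⟧ φ v))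
  hom-⟦⟧ (φ ∧̇ ψ) v = B.trans (f-∧ _ _) (B.∧-cong (hom-⟦⟧ φ v) (hom-⟦⟧ ψ v))
  hom-⟦⟧ (φ ∨̇ ψ) v = B.trans (f-∨ _ _) (B.∨-cong (hom-⟦⟧ φ v) (hom-⟦⟧ ψ v))

  hom-≈⊤ : ∀ φ v → A.⟦ φ ⟧ v A.≈ A.⊤ → B.⟦ φ ⟧ (f ∘ v) B.≈ B.⊤
  hom-≈⊤ φ v e = B.trans (B.sym (hom-⟦⟧ φ v)) (B.trans (f-cong e) f-⊤)

  ⊨-embedding : Injective A._≈_ B._≈_ f → ∀ φ → B.⊨ φ → A.⊨ φ
  ⊨-embedding inj φ valid v = inj
    (B.trans (hom-⟦⟧ φ v) (B.trans (valid (f ∘ v)) (B.sym f-⊤)))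

  -- Surjectivity supplies preimages of the values of a valuation in B, and so a
  -- valuation in A to lift it to.
  ⊨-surjection : Surjective A._≈_ B._≈_ f → ∀ φ → A.⊨ φ → B.⊨ φ
  ⊨-surjection surj φ valid v = B.trans
    (Evaluation.⟦⟧-cong B φ (λ p → B.sym (proj₂ (surj (v p)) A.refl)))
    (hom-≈⊤ φ (proj₁ ∘ surj ∘ v) (valid _))

id-hom : (A : S4Algebra ℓ) → IsHom A A (λ a → a)
id-hom A = record
  { f-cong = λ e → e
  ; f-⊤    = refl
  ; f-⊥    = refl
  ; f-¬    = λ _ → refl
  ; f-□    = λ _ → refl
  ; f-∧    = λ _ _ → refl
  ; f-∨    = λ _ _ → refl
  }
  where open S4Algebra A

module _ {I : Set ℓ} (F : I → S4Algebra ℓ) where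

  π-hom : ∀ i → IsHom (∏ F) (F i) (λ a → a i)
  π-hom i = record
    { f-cong = λ e → e i
    ; f-⊤    = refl
    ; f-⊥    = refl
    ; f-¬    = λ _ → refl
    ; f-□    = λ _ → refl
    ; f-∧    = λ _ _ → refl
    ; f-∨    = λ _ _ → refl
    }
    where open S4Algebra (F i)

  ⊨-∏ : ∀ φ → (∀ i → S4Algebra.⊨_ (F i) φ) → S4Algebra.⊨_ (∏ F) φ
  ⊨-∏ φ valid v i = trans (hom-⟦⟧ (π-hom i) φ v) (valid i _)
    where open S4Algebra (F i)

-- A is its own power over the one-point index set.
⊆HSP : {C : Pred (S4Algebra ℓ) k} → C ⊆ HSP C
⊆HSP {x = A} A∈C =
    A
  , (A , (Lift _ ⊤′ , (λ _ → A) , (λ _ → A∈C) , diagonal) , (λ a → a) , id-hom A , λ e → e)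
  , ((λ a → a) , id-hom A , λ a → a , λ e → e)
  where
  open S4Algebra A
  diagonal : Isomorphism A (∏ {I = Lift _ ⊤′} (λ _ → A))
  diagonal =
      (λ a _ → a)
    , record
      { f-cong = λ e _ → e
      ; f-⊤    = λ _ → refl
      ; f-⊥    = λ _ → refl
      ; f-¬    = λ _ _ → refl
      ; f-□    = λ _ _ → refl
      ; f-∧    = λ _ _ _ → refl
      ; f-∨    = λ _ _ _ → refl
      }
    , (λ e → e (lift _))
    , (λ a → a (lift _) , λ e _ → e)

Log-HSP : (C : Pred (S4Algebra ℓ) k) → Log (HSP C) ≐ Log C
Log-HSP C =
    (λ valid A A∈C → valid A (⊆HSP A∈C))
  , λ { {φ} valid A (S , (P , (I , F , F∈C , _ , iso , iso-inj , _) , _ , emb , emb-inj) , _ , sur , sur-sur) →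
        ⊨-surjection sur sur-sur φ
          (⊨-embedding emb emb-inj φ
            (⊨-embedding iso iso-inj φ
              (⊨-∏ F φ (λ i → valid (F i) (F∈C i))))) }

-- Subalgebras

record IsSubuniverse (B : S4Algebra ℓ) (P : Pred (S4Algebra.Carrier B) ℓ) : Set ℓ where
  open S4Algebra B
  field
    ⊤-in : ⊤ ∈ P
    ⊥-in : ⊥ ∈ P
    ¬-in : ∀ {a} → a ∈ P → ¬ a ∈ P
    □-in : ∀ {a} → a ∈ P → □ a ∈ P
    ∧-in : ∀ {a b} → a ∈ P → b ∈ P → a ∧ b ∈ P
    ∨-in : ∀ {a b} → a ∈ P → b ∈ P → a ∨ b ∈ P

module Subalgebra (B : S4Algebra ℓ) {P : Pred (S4Algebra.Carrier B) ℓ}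
                  (closed : IsSubuniverse B P) where
  open S4Algebra B
  open IsSubuniverse closed

  subalgebra : S4Algebra ℓ
  subalgebra = record
    { booleanAlgebra = record
      { Carrier = ∃ P
      ; _≈_ = λ a b → proj₁ a ≈ proj₁ b
      ; _∨_ = λ (a , p) (b , q) → a ∨ b , ∨-in p q
      ; _∧_ = λ (a , p) (b , q) → a ∧ b , ∧-in p q
      ; ¬_  = λ (a , p) → ¬ a , ¬-in p
      ; ⊤   = ⊤ , ⊤-in
      ; ⊥   = ⊥ , ⊥-in
      ; isBooleanAlgebra = record
        { isDistributiveLattice = record
          { isLattice = record
            { isEquivalence = record { refl = refl ; sym = sym ; trans = trans }
            ; ∨-comm     = λ (a , _) (b , _) → ∨-comm a b
            ; ∨-assoc    = λ (a , _) (b , _) (c , _) → ∨-assoc a b c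
            ; ∨-cong     = ∨-cong
            ; ∧-comm     = λ (a , _) (b , _) → ∧-comm a b
            ; ∧-assoc    = λ (a , _) (b , _) (c , _) → ∧-assoc a b c
            ; ∧-cong     = ∧-cong
            ; absorptive = (λ (a , _) (b , _) → ∨-absorbs-∧ a b)
                         , (λ (a , _) (b , _) → ∧-absorbs-∨ a b)
            }
          ; ∨-distrib-∧ = (λ (a , _) (b , _) (c , _) → ∨-distribˡ-∧ a b c)
                        , (λ (a , _) (b , _) (c , _) → ∨-distribʳ-∧ a b c)
          ; ∧-distrib-∨ = (λ (a , _) (b , _) (c , _) → ∧-distribˡ-∨ a b c)
                        , (λ (a , _) (b , _) (c , _) → ∧-distribʳ-∨ a b c)
          }
        ; ∨-complement = (λ (a , _) → ∨-complementˡ a) , (λ (a , _) → ∨-complementʳ a)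
        ; ∧-complement = (λ (a , _) → ∧-complementˡ a) , (λ (a , _) → ∧-complementʳ a)
        ; ¬-cong = ¬-cong
        }
      }
    ; □_     = λ (a , p) → □ a , □-in p
    ; □-cong = □-cong
    ; □-⊤    = □-⊤
    ; □-∧    = λ (a , _) (b , _) → □-∧ a b
    ; □-T    = λ (a , _) → □-T a
    ; □-4    = λ (a , _) → □-4 a
    }

  inclusion-hom : IsHom subalgebra B proj₁
  inclusion-hom = record
    { f-cong = λ e → e
    ; f-⊤    = refl
    ; f-⊥    = refl
    ; f-¬    = λ _ → refl
    ; f-□    = λ _ → refl
    ; f-∧    = λ _ _ → refl
    ; f-∨    = λ _ _ → refl
    }

  inclusion : Embedding subalgebra B
  inclusion = proj₁ , inclusion-hom , λ e → e

-- Enumerating pairs and formulas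

next : ℕ × ℕ → ℕ × ℕ
next (zero  , j) = suc j , zero
next (suc i , j) = i , suc j

-- The n-th point of the walk through ℕ × ℕ along successive antidiagonals.
unpair : ℕ → ℕ × ℕ
unpair zero    = zero , zero
unpair (suc n) = next (unpair n)

-- Induction on the antidiagonal s = i + j and then on the position j in it.
-- The start (suc s , 0) of an antidiagonal follows the end (0 , s) of the
-- previous one.
unpair-onto : ∀ s j i → i + j ≡ s → ∃[ n ] unpair n ≡ (i , j)
unpair-onto s       (suc j) i e =
  let n , eq = unpair-onto s j (suc i) (≡.trans (≡.sym (+-suc i j)) e)
  in suc n , ≡.cong next eq
unpair-onto zero    zero    zero    e = zero , ≡.refl
unpair-onto (suc s) zero    (suc i) e =
  let n , eq = unpair-onto s s zero ≡.refl
  in suc n , ≡.trans (≡.cong next eq)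
       (≡.cong (_, zero) (≡.trans (≡.sym e) (+-identityʳ (suc i))))

pair : ℕ → ℕ → ℕ
pair i j = proj₁ (unpair-onto (i + j) j i ≡.refl)

unpair-pair : ∀ i j → unpair (pair i j) ≡ (i , j)
unpair-pair i j = proj₂ (unpair-onto (i + j) j i ≡.refl)

-- Used to combine countably many valuations into one, after renaming their
-- letters apart by pair.
merge : {X : Set ℓ} → (ℕ → ℕ → X) → ℕ → X
merge w n = let i , j = unpair n in w i j

merge-pair : {X : Set ℓ} (w : ℕ → ℕ → X) → ∀ i j → merge w (pair i j) ≡ w i j
merge-pair w i j = ≡.cong (λ (a , b) → w a b) (unpair-pair i j)

height : Modal → ℕ
height (var p) = 1
height ⊤̇       = 1
height ⊥̇       = 1
height (¬̇ φ)   = suc (height φ)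
height (□̇ φ)   = suc (height φ)
height (φ ∧̇ ψ) = suc (height φ ⊔ height ψ)
height (φ ∨̇ ψ) = suc (height φ ⊔ height ψ)

-- The first argument bounds the height of the decoded formula and makes the
-- recursion structural.  At bound 0 the value ⊤̇ is a default, so leaves count
-- as height 1.
decode : ℕ → ℕ → Modal
decode-node : ℕ → ℕ × ℕ → Modal

decode zero    n = ⊤̇
decode (suc f) n = decode-node f (unpair n)

decode-node f (0 , n) = var n
decode-node f (1 , n) = ⊤̇
decode-node f (2 , n) = ⊥̇
decode-node f (3 , n) = ¬̇ decode f n
decode-node f (4 , n) = □̇ decode f n
decode-node f (5 , n) = decode f (proj₁ (unpair n)) ∧̇ decode f (proj₂ (unpair n))
decode-node f (_ , n) = decode f (proj₁ (unpair n)) ∨̇ decode f (proj₂ (unpair n))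

decode-onto : ∀ φ f → height φ ≤ⁿ f → ∃[ n ] decode f n ≡ φ
decode-onto (var p) (suc f) _ = pair 0 p , ≡.cong (decode-node f) (unpair-pair 0 p)
decode-onto ⊤̇       (suc f) _ = pair 1 0 , ≡.cong (decode-node f) (unpair-pair 1 0)
decode-onto ⊥̇       (suc f) _ = pair 2 0 , ≡.cong (decode-node f) (unpair-pair 2 0)
decode-onto (¬̇ φ)   (suc f) (s≤s φ≤f) =
  let n , eq = decode-onto φ f φ≤f
  in pair 3 n , ≡.trans (≡.cong (decode-node f) (unpair-pair 3 n)) (≡.cong ¬̇_ eq)
decode-onto (□̇ φ)   (suc f) (s≤s φ≤f) =
  let n , eq = decode-onto φ f φ≤f
  in pair 4 n , ≡.trans (≡.cong (decode-node f) (unpair-pair 4 n)) (≡.cong □̇_ eq)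
decode-onto (φ ∧̇ ψ) (suc f) (s≤s φψ≤f) =
  let n , eq  = decode-onto φ f (m⊔n≤o⇒m≤o _ _ φψ≤f)
      o , eq′ = decode-onto ψ f (m⊔n≤o⇒n≤o (height φ) _ φψ≤f)
  in pair 5 (pair n o)
   , ≡.trans (≡.cong (decode-node f) (unpair-pair 5 (pair n o)))
       (≡.trans (≡.cong (λ (i , j) → decode f i ∧̇ decode f j) (unpair-pair n o))
                (≡.cong₂ _∧̇_ eq eq′))
decode-onto (φ ∨̇ ψ) (suc f) (s≤s φψ≤f) =
  let n , eq  = decode-onto φ f (m⊔n≤o⇒m≤o _ _ φψ≤f)
      o , eq′ = decode-onto ψ f (m⊔n≤o⇒n≤o (height φ) _ φψ≤f)
  in pair 6 (pair n o)
   , ≡.trans (≡.cong (decode-node f) (unpair-pair 6 (pair n o)))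
       (≡.trans (≡.cong (λ (i , j) → decode f i ∨̇ decode f j) (unpair-pair n o))
                (≡.cong₂ _∨̇_ eq eq′))

enumerate : ℕ → Modal
enumerate = merge decode

enumerate-onto : ∀ φ → ∃[ n ] enumerate n ≡ φ
enumerate-onto φ =
  let n , eq = decode-onto φ (height φ) ≤ⁿ-refl
  in pair (height φ) n , ≡.trans (merge-pair decode (height φ) n) eq

-- Terms over generators

module GeneratingTerms (A : S4Algebra ℓ) {X : Set ℓ} (x₀ : X)
                       (ι : X → S4Algebra.Carrier A) where
  open S4Algebra A
  open Evaluation A

  -- Renaming the letters of φ apart by pair p makes it read the p-th of the
  -- merged valuations.
  ⟦⟧-merge : ∀ φ w p → ⟦ φ [ var ∘ pair p ] ⟧ (ι ∘ merge w) ≈ ⟦ φ ⟧ (ι ∘ w p)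
  ⟦⟧-merge φ w p = trans (reflexive (⟦⟧-[] φ (var ∘ pair p)))
    (⟦⟧-cong φ (λ q → reflexive (≡.cong ι (merge-pair w p q))))

  Term : Carrier → Set ℓ
  Term a = ∃[ φ ] ∃[ w ] ⟦ φ ⟧ (ι ∘ w) ≈ a

  -- The two halves of a binary combination may use the same letters for
  -- different generators; both is merged to keep them apart.
  both : (ℕ → X) → (ℕ → X) → ℕ → ℕ → X
  both w w′ zero    = w
  both w w′ (suc _) = w′

  term : ∀ {a} → Generated booleanAlgebra ι a → Term a
  term (gen i)   = var 0 , (λ _ → i) , refl
  term ⊤-cl      = ⊤̇ , (λ _ → x₀) , refl
  term ⊥-cl      = ⊥̇ , (λ _ → x₀) , refl
  term (¬-cl g)  = let φ , w , e = term g in ¬̇ φ , w , ¬-cong e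
  term (∧-cl g h) =
    let φ , w  , e  = term g
        ψ , w′ , e′ = term h
    in φ [ var ∘ pair 0 ] ∧̇ ψ [ var ∘ pair 1 ] , merge (both w w′)
     , ∧-cong (trans (⟦⟧-merge φ (both w w′) 0) e) (trans (⟦⟧-merge ψ (both w w′) 1) e′)
  term (∨-cl g h) =
    let φ , w  , e  = term g
        ψ , w′ , e′ = term h
    in φ [ var ∘ pair 0 ] ∨̇ ψ [ var ∘ pair 1 ] , merge (both w w′)
     , ∨-cong (trans (⟦⟧-merge φ (both w w′) 0) e) (trans (⟦⟧-merge ψ (both w w′) 1) e′)
  term (≈-cl e g) = let φ , w , e′ = term g in φ , w , trans e′ e

  -- A single valuation in the generators has to serve all letters at once:
  -- letter q of the formula for v p becomes letter pair p q.
  terms : (∀ a → Generated booleanAlgebra ι a) → (v : ℕ → Carrier) →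
          ∃[ s ] ∃[ w ] (∀ p → ⟦ s p ⟧ (ι ∘ w) ≈ v p)
  terms generated v =
      (λ p → φ p [ var ∘ pair p ]) , merge w
    , λ p → trans (⟦⟧-merge (φ p) w p) (proj₂ (proj₂ (term (generated (v p)))))
    where
    φ : ℕ → Modal
    φ p = proj₁ (term (generated (v p)))
    w : ℕ → ℕ → X
    w p = proj₁ (proj₂ (term (generated (v p))))

-- Heyting algebras of open elements and the translation

module HeytingEvaluation (H : HA ℓ) where
  open HeytingAlgebra H

  ⟦_⟧ᴴ : Int → (ℕ → Carrier) → Carrier
  ⟦ var p ⟧ᴴ v = v p
  ⟦ ⊤̇ ⟧ᴴ     v = ⊤
  ⟦ ⊥̇ ⟧ᴴ     v = ⊥
  ⟦ φ ∧̇ ψ ⟧ᴴ v = ⟦ φ ⟧ᴴ v ∧ ⟦ ψ ⟧ᴴ v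
  ⟦ φ ∨̇ ψ ⟧ᴴ v = ⟦ φ ⟧ᴴ v ∨ ⟦ ψ ⟧ᴴ v
  ⟦ φ ⇒̇ ψ ⟧ᴴ v = ⟦ φ ⟧ᴴ v ⇨ ⟦ ψ ⟧ᴴ v

-- Equivalently, j is a Heyting homomorphism into the algebra of open
-- elements of A.
record IsOpenHom (H : HA ℓ) (A : S4Algebra ℓ)
                 (j : HeytingAlgebra.Carrier H → S4Algebra.Carrier A) : Set ℓ where
  private
    module H = HeytingAlgebra H
    module A = S4Algebra A
  field
    j-cong : Congruent H._≈_ A._≈_ j
    j-⊤    : j H.⊤ A.≈ A.⊤
    j-⊥    : j H.⊥ A.≈ A.⊥
    j-∧    : ∀ a b → j (a H.∧ b) A.≈ j a A.∧ j b
    j-∨    : ∀ a b → j (a H.∨ b) A.≈ j a A.∨ j b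
    j-⇨    : ∀ a b → j (a H.⇨ b) A.≈ A.□ (A.¬ j a A.∨ j b)
    j-open : ∀ a → A.□ j a A.≈ j a

  open HeytingEvaluation H

  -- The Gödel translation computes Heyting values among the open elements.
  j-GMT : ∀ φ v → j (⟦ φ ⟧ᴴ v) A.≈ A.⟦ GMT φ ⟧ (j ∘ v)
  j-GMT (var p) v = A.sym (j-open (v p))
  j-GMT ⊤̇       v = j-⊤
  j-GMT ⊥̇       v = j-⊥
  j-GMT (φ ∧̇ ψ) v = A.trans (j-∧ _ _) (A.∧-cong (j-GMT φ v) (j-GMT ψ v))
  j-GMT (φ ∨̇ ψ) v = A.trans (j-∨ _ _) (A.∨-cong (j-GMT φ v) (j-GMT ψ v))
  j-GMT (φ ⇒̇ ψ) v =
    A.trans (j-⇨ _ _) (A.□-cong (A.∨-cong (A.¬-cong (j-GMT φ v)) (j-GMT ψ v)))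

opens-openHom : (B : S4Algebra ℓ) → IsOpenHom (opens B) B proj₁
opens-openHom B = record
  { j-cong = λ e → e
  ; j-⊤    = refl
  ; j-⊥    = refl
  ; j-∧    = λ _ _ → refl
  ; j-∨    = λ _ _ → refl
  ; j-⇨    = λ _ _ → refl
  ; j-open = λ (_ , a-open) → sym a-open
  }
  where open S4Algebra B

openHom-∘-iso : {G H : HA ℓ} {A : S4Algebra ℓ}
  {j : HeytingAlgebra.Carrier H → S4Algebra.Carrier A} →
  IsOpenHom H A j → (i : HeytingIso G H) → IsOpenHom G A (j ∘ HeytingIso.to i)
openHom-∘-iso {A = A} h i = record
  { j-cong = j-cong ∘ to-cong
  ; j-⊤    = trans (j-cong to-⊤) j-⊤
  ; j-⊥    = trans (j-cong to-⊥) j-⊥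
  ; j-∧    = λ a b → trans (j-cong (to-∧ a b)) (j-∧ _ _)
  ; j-∨    = λ a b → trans (j-cong (to-∨ a b)) (j-∨ _ _)
  ; j-⇨    = λ a b → trans (j-cong (to-⇨ a b)) (j-⇨ _ _)
  ; j-open = λ a → j-open _
  }
  where
  open S4Algebra A using (trans)
  open IsOpenHom h
  open HeytingIso i hiding (to)

-- Elements of an envelope are equal when the same prime filters lie in their
-- extensions, so the lattice clauses are the prime filter axioms.  The clause
-- for implication is the box formula for a single pair; taking ⊤ as the
-- antecedent in it shows that the generators are open.
envelope-openHom : {H : HA ℓ} {A : S4Algebra ℓ} (env : IsBooleanEnvelope H A) →
                   IsOpenHom H A (IsBooleanEnvelope.ι env)
envelope-openHom {H = H} {A = A} env = record
  { j-cong = ι-cong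
  ; j-⊤    = ι-⊤
  ; j-⊥    = ext≐⇒≈ (λ {x} p → ⊥-elim (PrimeFilter.proper x (proj₁ (ext-ι _) p)))
                    (λ p → ⊥-elim (proj₁ ext-⊥ p))
  ; j-∧    = λ a b → ext≐⇒≈
      (λ {x} p → let q = proj₁ (ext-ι _) p in proj₂ (ext-∧ _ _)
        ( proj₂ (ext-ι _) (PrimeFilter.upward x (H.x∧y≤x a b) q)
        , proj₂ (ext-ι _) (PrimeFilter.upward x (H.x∧y≤y a b) q)))
      (λ {x} p → let q , r = proj₁ (ext-∧ _ _) p in proj₂ (ext-ι _)
        (PrimeFilter.∧-closed x (proj₁ (ext-ι _) q) (proj₁ (ext-ι _) r)))
  ; j-∨    = λ a b → ext≐⇒≈
      (λ {x} p → proj₂ (ext-∨ _ _)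
        (Sum.map (proj₂ (ext-ι _)) (proj₂ (ext-ι _))
          (PrimeFilter.prime x (proj₁ (ext-ι _) p))))
      (λ {x} p → proj₂ (ext-ι _)
        (Sum.[ PrimeFilter.upward x (H.x≤x∨y a b) ∘ proj₁ (ext-ι _)
             , PrimeFilter.upward x (H.y≤x∨y a b) ∘ proj₁ (ext-ι _) ]
          (proj₁ (ext-∨ _ _) p)))
  ; j-⇨    = ι-⇨
  ; j-open = λ a → begin
      □ ι a                ≈⟨ □-cong (∨-identityˡ _) ⟨
      □ (⊥ ∨ ι a)          ≈⟨ □-cong (∨-congʳ (trans (¬-cong ι-⊤) ¬⊤≈⊥)) ⟨
      □ (¬ ι H.⊤ ∨ ι a)    ≈⟨ ι-⇨ H.⊤ a ⟨
      ι (H.⊤ H.⇨ a)        ≈⟨ ι-cong (H.antisym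
                                (H.trans (H.∧-greatest H.refl (H.maximum _))
                                         (H.transpose-∧ H.refl))
                                (H.transpose-⇨ (H.x∧y≤x a H.⊤))) ⟩
      ι a                  ∎
  }
  where
  module H = HeytingAlgebra H
  open S4Algebra A
  open BooleanAlgebraProperties booleanAlgebra
  open SetoidReasoning setoid
  open IsBooleanEnvelope env

  ext≐⇒≈ : ∀ {a b} → ext a ⊆ ext b → ext b ⊆ ext a → a ≈ b
  ext≐⇒≈ p q = from (ext-≈ _ _) (p , q)

  ι-⊤ : ι H.⊤ ≈ ⊤
  ι-⊤ = ext≐⇒≈ (λ _ → proj₂ ext-⊤ _)
               (λ {x} _ → proj₂ (ext-ι H.⊤) (PrimeFilter.⊤-member x))

  ι-cong : ∀ {a b} → a H.≈ b → ι a ≈ ι b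
  ι-cong e = ext≐⇒≈
    (λ {x} p → proj₂ (ext-ι _) (PrimeFilter.upward x (H.reflexive e) (proj₁ (ext-ι _) p)))
    (λ {x} p → proj₂ (ext-ι _)
      (PrimeFilter.upward x (H.reflexive (H.Eq.sym e)) (proj₁ (ext-ι _) p)))

  ι-⇨ : ∀ a b → ι (a H.⇨ b) ≈ □ (¬ ι a ∨ ι b)
  ι-⇨ a b = begin
    ι (a H.⇨ b)             ≈⟨ ι-cong (H.antisym (H.∧-greatest H.refl (H.maximum _))
                                                 (H.x∧y≤x _ _)) ⟩
    ι ((a H.⇨ b) H.∧ H.⊤)   ≈⟨ □-meet ((a , b) ∷ []) ⟨
    □ ((¬ ι a ∨ ι b) ∧ ⊤)   ≈⟨ □-cong (∧-identityʳ _) ⟩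
    □ (¬ ι a ∨ ι b)         ∎

-- Validity of a modal formula at open arguments is a statement about the
-- Heyting algebra H of those arguments alone, namely that interior φ has value
-- ⊤ there.  Injectivity of i brings this statement from B back to H, and j
-- carries it on to A.
⊨-transfer : {H : HA ℓ} {A B : S4Algebra ℓ}
  {i : HeytingAlgebra.Carrier H → S4Algebra.Carrier B}
  {j : HeytingAlgebra.Carrier H → S4Algebra.Carrier A} →
  IsOpenHom H B i → Injective (HeytingAlgebra._≈_ H) (S4Algebra._≈_ B) i →
  IsOpenHom H A j → ∀ φ w →
  S4Algebra._≈_ B (S4Algebra.⟦_⟧ B φ (i ∘ w)) (S4Algebra.⊤ B) →
  S4Algebra._≈_ A (S4Algebra.⟦_⟧ A φ (j ∘ w)) (S4Algebra.⊤ A)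
⊨-transfer {H = H} {A = A} {B = B} {i = i} {j = j} hi inj hj φ w e =
  A.trans (Evaluation.⟦⟧-cong A φ (λ p → A.sym (J.j-open (w p))))
    (from (ClausalForm.valid⇔interior A (j ∘ w) φ)
      (A.trans (A.sym (J.j-GMT (interior φ) w))
        (A.trans (J.j-cong interior≈⊤) J.j-⊤)))
  where
  module A = S4Algebra A
  module B = S4Algebra B
  module J = IsOpenHom hj
  module I = IsOpenHom hi
  open HeytingAlgebra H using (_≈_; ⊤)
  open HeytingEvaluation H

  interior≈⊤ : ⟦ interior φ ⟧ᴴ w ≈ ⊤
  interior≈⊤ = inj (B.trans (I.j-GMT (interior φ) w)
    (B.trans
      (to (ClausalForm.valid⇔interior B (i ∘ w) φ)
        (B.trans (Evaluation.⟦⟧-cong B φ (λ p → I.j-open (w p))) e))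
      (B.sym I.j-⊤)))

module _ (K : Pred (S4Algebra ℓ) k) where

  Envelope : Pred (S4Algebra ℓ) _
  Envelope A = ∃[ H ] H ∈ ρᵃ K × IsBooleanEnvelope H A

  -- Write a valuation v in A as the values of formulas s p at open elements w.
  -- Then φ at v is φ[s] at w, which transfers from B, where it is an instance
  -- of the hypothesis because the entries of w are open.
  Schem⊆Log-envelopes : Schem (Log K ^□) ⊆ Log Envelope
  Schem⊆Log-envelopes {φ} schem A (H , (B , B∈K , iso) , env) v =
    A.trans (Evaluation.⟦⟧-cong A φ (λ p → A.sym (sw≈v p)))
      (A.trans (A.reflexive (≡.sym (Evaluation.⟦⟧-[] A φ s)))
        (⊨-transfer (opens-openHom B) (λ e → e) J (φ [ s ]) w valid))
    where
    module A = S4Algebra A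
    module B = S4Algebra B
    open IsBooleanEnvelope env using (ι; generated)
    open HeytingIso iso using (surjective) renaming (to to toᴴ)
    module H = HeytingAlgebra H

    J : IsOpenHom (opens B) A (ι ∘ toᴴ)
    J = openHom-∘-iso (envelope-openHom env) iso

    terms = GeneratingTerms.terms A H.⊤ ι generated v
    s = proj₁ terms

    w : ℕ → HeytingAlgebra.Carrier (opens B)
    w q = proj₁ (surjective (proj₁ (proj₂ terms) q))

    sw≈v : ∀ p → A.⟦ s p ⟧ (ι ∘ toᴴ ∘ w) A.≈ v p
    sw≈v p = A.trans
      (Evaluation.⟦⟧-cong A (s p) λ q →
        IsOpenHom.j-cong (envelope-openHom env) (proj₂ (surjective _) B.refl))
      (proj₂ (proj₂ terms) p)

    valid : B.⟦ φ [ s ] ⟧ (proj₁ ∘ w) B.≈ B.⊤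
    valid = B.trans
      (Evaluation.⟦⟧-cong B (φ [ s ]) (λ q → proj₂ (w q)))
      (B.trans (B.reflexive (≡.sym (Evaluation.⟦⟧-[] B (φ [ s ]) _)))
               (schem s B B∈K (proj₁ ∘ w)))

-- Ultrafilters of countable Boolean algebras

module BooleanOrder (B : BooleanAlgebra ℓ ℓ) where
  open BooleanAlgebra B
  open BooleanAlgebraProperties B public
  open Poset poset public using (_≤_)
    renaming (refl to ≤-refl; trans to ≤-trans; reflexive to ≤-reflexive; antisym to ≤-antisym)
  open IsLattice ∨-∧-isOrderTheoreticLattice public
    using (x≤x∨y; y≤x∨y; ∨-least; x∧y≤x; x∧y≤y; ∧-greatest)
  open SetoidReasoning setoid

  ∧¬≈⊥⇒≤ : ∀ {a b} → a ∧ ¬ b ≈ ⊥ → a ≤ b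
  ∧¬≈⊥⇒≤ {a} {b} e = begin
    a                     ≈⟨ ∧-identityʳ a ⟨
    a ∧ ⊤                 ≈⟨ ∧-congˡ (∨-complementʳ b) ⟨
    a ∧ (b ∨ ¬ b)         ≈⟨ ∧-distribˡ-∨ a b (¬ b) ⟩
    (a ∧ b) ∨ (a ∧ ¬ b)   ≈⟨ ∨-congˡ e ⟩
    (a ∧ b) ∨ ⊥           ≈⟨ ∨-identityʳ _ ⟩
    a ∧ b                 ∎

  ∨∧¬≤ : ∀ a b → (a ∨ b) ∧ ¬ a ≤ b
  ∨∧¬≤ a b = ≤-trans
    (≤-reflexive (trans (∧-distribʳ-∨ (¬ a) a b)
                 (trans (∨-congʳ (∧-complementʳ a)) (∨-identityˡ _))))
    (x∧y≤x b (¬ a))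

  ¬-antitone : ∀ {a b} → a ≤ b → ¬ b ≤ ¬ a
  ¬-antitone {a} {b} a≤b = ≤-trans (y≤x∨y (¬ a) (¬ b))
    (≤-reflexive (sym (trans (¬-cong a≤b) (deMorgan₁ a b))))

record Ultrafilter (B : BooleanAlgebra ℓ ℓ) : Set (Level.suc ℓ) where
  open BooleanAlgebra B
  open BooleanOrder B
  field
    member   : Pred Carrier ℓ
    upward   : ∀ {a b} → a ≤ b → a ∈ member → b ∈ member
    ∧-closed : ∀ {a b} → a ∈ member → b ∈ member → a ∧ b ∈ member
    ⊤-member : ⊤ ∈ member
    proper   : Not (⊥ ∈ member)
    decides  : ∀ a → a ∈ member ⊎ ¬ a ∈ member

  consistent : ∀ {a} → a ∈ member → Not (¬ a ∈ member)
  consistent {a} p q = proper (upward (≤-reflexive (∧-complementʳ a)) (∧-closed p q))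

  ∉⇒¬∈ : ∀ {a} → Not (a ∈ member) → ¬ a ∈ member
  ∉⇒¬∈ {a} a∉ with decides a
  ... | inj₁ a∈  = ⊥-elim (a∉ a∈)
  ... | inj₂ ¬a∈ = ¬a∈

  prime : ∀ {a b} → a ∨ b ∈ member → a ∈ member ⊎ b ∈ member
  prime {a} {b} p with decides a
  ... | inj₁ a∈  = inj₁ a∈
  ... | inj₂ ¬a∈ = inj₂ (upward (∨∧¬≤ a b) (∧-closed p ¬a∈))

module CountableUltrafilter (em : ExcludedMiddle ℓ) (B : BooleanAlgebra ℓ ℓ)
    (e : ℕ → BooleanAlgebra.Carrier B)
    (e-onto : ∀ a → ∃[ n ] BooleanAlgebra._≈_ B (e n) a) where
  open BooleanAlgebra B
  open BooleanOrder B

  -- One step of the construction: meet the current element with a unless that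
  -- gives ⊥, in which case the current element already lies below ¬ a.
  refine : ∀ u a → Dec (u ∧ a ≈ ⊥) → Carrier
  refine u a (yes _) = u
  refine u a (no  _) = u ∧ a

  refine-≤ : ∀ u a d → refine u a d ≤ u
  refine-≤ u a (yes _) = ≤-refl
  refine-≤ u a (no  _) = x∧y≤x u a

  refine-≉⊥ : ∀ {u a} d → Not (u ≈ ⊥) → Not (refine u a d ≈ ⊥)
  refine-≉⊥ (yes _)  u≉⊥ = u≉⊥
  refine-≉⊥ (no ua≉⊥) _  = ua≉⊥

  refine-decides : ∀ u a d → refine u a d ≤ a ⊎ refine u a d ≤ ¬ a
  refine-decides u a (yes ua≈⊥) =
    inj₂ (∧¬≈⊥⇒≤ (trans (∧-congˡ (¬-involutive a)) ua≈⊥))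
  refine-decides u a (no _)     = inj₁ (x∧y≤y u a)

  module _ {a₀ : Carrier} (a₀≉⊥ : Not (a₀ ≈ ⊥)) where

    -- The ultrafilter is generated by a decreasing sequence of nonzero elements
    -- that decides the enumerated elements in turn.
    chain : ℕ → Carrier
    chain zero    = a₀
    chain (suc n) = refine (chain n) (e n) em

    chain-≉⊥ : ∀ n → Not (chain n ≈ ⊥)
    chain-≉⊥ zero    = a₀≉⊥
    chain-≉⊥ (suc n) = refine-≉⊥ em (chain-≉⊥ n)

    chain-antitone : ∀ n k → chain (n + k) ≤ chain k
    chain-antitone zero    k = ≤-refl
    chain-antitone (suc n) k = ≤-trans (refine-≤ _ _ em) (chain-antitone n k)

    ultrafilter : Ultrafilter B
    ultrafilter = record
      { member   = λ a → ∃[ n ] chain n ≤ a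
      ; upward   = λ a≤b (n , p) → n , ≤-trans p a≤b
      ; ∧-closed = λ (n , p) (k , q) → n + k , ∧-greatest
          (≤-trans (≡.subst (λ i → chain i ≤ chain n) (+-comm k n) (chain-antitone k n)) p)
          (≤-trans (chain-antitone n k) q)
      ; ⊤-member = 0 , sym (∧-identityʳ _)
      ; proper   = λ (n , p) → chain-≉⊥ n (trans p (∧-zeroʳ _))
      ; decides  = λ a → let n , eₙ≈a = e-onto a in
          Sum.map (λ p → suc n , ≤-trans p (≤-reflexive eₙ≈a))
                  (λ p → suc n , ≤-trans p (≤-reflexive (¬-cong eₙ≈a)))
                  (refine-decides (chain n) (e n) em)
      }

    a₀∈ultrafilter : a₀ ∈ Ultrafilter.member ultrafilter
    a₀∈ultrafilter = 0 , ≤-refl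

-- The Boolean envelope inside a countable S4-algebra

module OpenHull (em : ExcludedMiddle ℓ) (B : S4Algebra ℓ) where
  open S4Algebra B using (booleanAlgebra; Carrier; _≈_; _∧_; _∨_; ¬_; ⊤; ⊥; □_;
    □-∧; □-⊤; sym; trans; ∧-congˡ; ∨-distribˡ-∧; ∨-complementʳ; ¬-cong)
  open BooleanOrder booleanAlgebra
  open Evaluation B using (□-idem)
  private
    module O = HeytingAlgebra (opens B)

  isSubuniverse : IsSubuniverse B (Generated booleanAlgebra {I = O.Carrier} proj₁)
  isSubuniverse = record
    { ⊤-in = ⊤-cl
    ; ⊥-in = ⊥-cl
    ; ¬-in = ¬-cl
    ; □-in = λ {a} _ → gen (□ a , sym (□-idem a))
    ; ∧-in = ∧-cl
    ; ∨-in = ∨-cl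
    }

  open Subalgebra B isSubuniverse public
    renaming (subalgebra to hull; inclusion-hom to hull-hom)

  private
    module A = S4Algebra hull

  ι : O.Carrier → A.Carrier
  ι c = proj₁ c , gen c

  ι-generates : ∀ {a} (g : Generated booleanAlgebra proj₁ a) →
                Generated A.booleanAlgebra ι (a , g)
  ι-generates (gen c)    = gen c
  ι-generates ⊤-cl       = ⊤-cl
  ι-generates ⊥-cl       = ⊥-cl
  ι-generates (¬-cl g)   = ¬-cl (ι-generates g)
  ι-generates (∧-cl g h) = ∧-cl (ι-generates g) (ι-generates h)
  ι-generates (∨-cl g h) = ∨-cl (ι-generates g) (ι-generates h)
  ι-generates (≈-cl e g) = ≈-cl e (ι-generates g)

  -- The filter of B generated by the members c of x and the complements of the
  -- nonmembers d.  As x is closed under ∧ and prime, a single c and a single d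
  -- suffice for each element.  On the hull this is the only ultrafilter whose
  -- open members are exactly those of x.
  Above : PrimeFilter (opens B) → Pred Carrier ℓ
  Above x a = ∃[ c ] ∃[ d ]
    (c ∈ member × Not (d ∈ member) × proj₁ c ≤ proj₁ d ∨ a)
    where open PrimeFilter x

  module _ (x : PrimeFilter (opens B)) where
    open PrimeFilter x

    above-upward : ∀ {a b} → a ≤ b → Above x a → Above x b
    above-upward a≤b (c , d , c∈ , d∉ , p) = c , d , c∈ , d∉ ,
      ≤-trans p (∨-least (x≤x∨y _ _) (≤-trans a≤b (y≤x∨y _ _)))

    above-∧ : ∀ {a b} → Above x a → Above x b → Above x (a ∧ b)
    above-∧ {a} {b} (c , d , c∈ , d∉ , p) (c′ , d′ , c′∈ , d′∉ , q) =
        c O.∧ c′ , d O.∨ d′ , ∧-closed c∈ c′∈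
      , (λ dd′∈ → Sum.[ d∉ , d′∉ ] (prime dd′∈))
      , ≤-trans
          (∧-greatest
            (≤-trans (x∧y≤x _ _) (≤-trans p (∨-least
              (≤-trans (x≤x∨y _ _) (x≤x∨y _ _)) (y≤x∨y _ _))))
            (≤-trans (x∧y≤y _ _) (≤-trans q (∨-least
              (≤-trans (y≤x∨y _ _) (x≤x∨y _ _)) (y≤x∨y _ _)))))
          (≤-reflexive (sym (∨-distribˡ-∧ _ a b)))

    above-proper : Not (Above x ⊥)
    above-proper (c , d , c∈ , d∉ , p) =
      d∉ (upward (≤-trans p (≤-reflexive (∨-identityʳ _))) c∈)

    above-open : ∀ {c} → c ∈ member → Above x (proj₁ c)
    above-open {c} c∈ = c , O.⊥ , c∈ , proper , y≤x∨y _ _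

    above-¬open : ∀ {c} → Not (c ∈ member) → Above x (¬ proj₁ c)
    above-¬open {c} c∉ = O.⊤ , c , ⊤-member , c∉ ,
      ≤-reflexive (sym (∨-complementʳ (proj₁ c)))

    above-open⁻¹ : ∀ {c} → Above x (proj₁ c) → c ∈ member
    above-open⁻¹ {c} (c′ , d , c′∈ , d∉ , p)
      with prime {d} {c} (upward p c′∈)
    ... | inj₁ d∈ = ⊥-elim (d∉ d∈)
    ... | inj₂ c∈ = c∈

    -- The generators are decided by excluded middle, and the decided elements
    -- form a Boolean subalgebra.
    above-decides : ∀ {a} → Generated booleanAlgebra proj₁ a →
                    Above x a ⊎ Above x (¬ a)
    above-decides (gen c) with em {c ∈ member}
    ... | yes c∈ = inj₁ (above-open c∈)
    ... | no  c∉ = inj₂ (above-¬open c∉)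
    above-decides ⊤-cl = inj₁ (above-open ⊤-member)
    above-decides ⊥-cl = inj₂ (above-¬open proper)
    above-decides (¬-cl g) =
      Sum.swap (Sum.map₁ (above-upward (≤-reflexive (sym (¬-involutive _)))) (above-decides g))
    above-decides (∧-cl g h) with above-decides g | above-decides h
    ... | inj₁ p | inj₁ q = inj₁ (above-∧ p q)
    ... | inj₂ p | _      = inj₂ (above-upward (¬-antitone (x∧y≤x _ _)) p)
    ... | _      | inj₂ q = inj₂ (above-upward (¬-antitone (x∧y≤y _ _)) q)
    above-decides (∨-cl g h) with above-decides g | above-decides h
    ... | inj₁ p | _      = inj₁ (above-upward (x≤x∨y _ _) p)
    ... | _      | inj₁ q = inj₁ (above-upward (y≤x∨y _ _) q)
    ... | inj₂ p | inj₂ q =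
      inj₂ (above-upward (≤-reflexive (sym (deMorgan₂ _ _))) (above-∧ p q))
    above-decides (≈-cl e g) =
      Sum.map (above-upward (≤-reflexive e))
              (above-upward (≤-reflexive (¬-cong e))) (above-decides g)

    hull-ultrafilter : Ultrafilter A.booleanAlgebra
    hull-ultrafilter = record
      { member   = Above x ∘ proj₁
      ; upward   = above-upward
      ; ∧-closed = above-∧
      ; ⊤-member = above-open ⊤-member
      ; proper   = above-proper
      ; decides  = λ (_ , g) → above-decides g
      }

  trace : Ultrafilter booleanAlgebra → PrimeFilter (opens B)
  trace U = record
    { member   = λ c → proj₁ c ∈ member
    ; upward   = upward
    ; ∧-closed = ∧-closed
    ; ⊤-member = ⊤-member
    ; proper   = proper
    ; prime    = prime
    }
    where open Ultrafilter U

  above-trace : ∀ U {a} → Above (trace U) a → a ∈ Ultrafilter.member U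
  above-trace U {a} (c , d , c∈ , d∉ , p) with Ultrafilter.prime U (Ultrafilter.upward U p c∈)
  ... | inj₁ d∈ = ⊥-elim (d∉ d∈)
  ... | inj₂ a∈ = a∈

  module _ (e : ℕ → Carrier) (e-onto : ∀ a → ∃[ n ] e n ≈ a) where
    open CountableUltrafilter em booleanAlgebra e e-onto

    -- The prime filter theorem for the opens of a countable algebra.  If a ≤ b
    -- fails, some ultrafilter contains a and ¬ b; the prime filter of its open
    -- members has a, but not b, in the ultrafilter that it generates.
    separation : ∀ {a b} → Generated booleanAlgebra proj₁ a →
                 (∀ x → Above x a → Above x b) → a ≤ b
    separation {a} {b} g ext⊆ = decidable-stable em λ a≰b →
      let a∧¬b≉⊥ = a≰b ∘ ∧¬≈⊥⇒≤
          U   = ultrafilter a∧¬b≉⊥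
          x   = trace U
          a∈  = Ultrafilter.upward U (x∧y≤x a (¬ b)) (a₀∈ultrafilter a∧¬b≉⊥)
          ¬b∈ = Ultrafilter.upward U (x∧y≤y a (¬ b)) (a₀∈ultrafilter a∧¬b≉⊥)
      in Sum.[ (λ p → Ultrafilter.consistent U (above-trace U (ext⊆ x p)) ¬b∈)
             , (λ p → Ultrafilter.consistent U a∈ (above-trace U p))
             ] (above-decides x g)

    hull-isEnvelope : IsBooleanEnvelope (opens B) hull
    hull-isEnvelope = record
      { ext       = λ (a , _) x → Above x a
      ; ext-≈     = λ (a , g) (b , h) → mk⇔
          (λ a≈b → (λ {x} → above-upward x (≤-reflexive a≈b))
                 , (λ {x} → above-upward x (≤-reflexive (sym a≈b))))
          (λ (p , q) → ≤-antisym (separation g (λ x → p {x})) (separation h (λ x → q {x})))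
      ; ext-⊤     = _ , λ {x} _ → Ultrafilter.⊤-member (hull-ultrafilter x)
      ; ext-⊥     = (λ {x} → above-proper x) , λ ()
      ; ext-¬     = λ a → (λ {x} p q → Ultrafilter.consistent (hull-ultrafilter x) {a} q p)
                        , (λ {x} → Ultrafilter.∉⇒¬∈ (hull-ultrafilter x) {a})
      ; ext-∧     = λ a b → (λ {x} p → above-upward x (x∧y≤x _ _) p , above-upward x (x∧y≤y _ _) p)
                          , (λ {x} (p , q) → above-∧ x p q)
      ; ext-∨     = λ a b → (λ {x} → Ultrafilter.prime (hull-ultrafilter x) {a} {b})
                          , (λ {x} → Sum.[ above-upward x (x≤x∨y _ _) , above-upward x (y≤x∨y _ _) ])
      ; ι         = ι
      ; ext-ι     = λ c → (λ {x} → above-open⁻¹ x) , (λ {x} → above-open x)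
      ; generated = λ (_ , g) → ι-generates g
      ; □-meet    = □-meet
      }
      where
      □-meet : ∀ cds →
        A.□ foldr A._∧_ A.⊤ (map (λ (c , d) → A.¬ ι c A.∨ ι d) cds)
          A.≈ ι (foldr O._∧_ O.⊤ (map (λ (c , d) → c O.⇨ d) cds))
      □-meet []         = □-⊤
      □-meet (cd ∷ cds) = trans (□-∧ _ _) (∧-congˡ (□-meet cds))

-- The values of all modal formulas at v.  Formulas can be enumerated, so this
-- subalgebra is countable.
module GeneratedSubalgebra (B : S4Algebra ℓ) (v : ℕ → S4Algebra.Carrier B) where
  open S4Algebra B

  isSubuniverse : IsSubuniverse B (λ a → ∃[ φ ] ⟦ φ ⟧ v ≈ a)
  isSubuniverse = record
    { ⊤-in = ⊤̇ , refl
    ; ⊥-in = ⊥̇ , refl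
    ; ¬-in = λ (φ , e) → ¬̇ φ , ¬-cong e
    ; □-in = λ (φ , e) → □̇ φ , □-cong e
    ; ∧-in = λ (φ , e) (ψ , e′) → φ ∧̇ ψ , ∧-cong e e′
    ; ∨-in = λ (φ , e) (ψ , e′) → φ ∨̇ ψ , ∨-cong e e′
    }

  open Subalgebra B isSubuniverse public

  generator : ℕ → S4Algebra.Carrier subalgebra
  generator p = v p , var p , refl

  enumeration : ℕ → S4Algebra.Carrier subalgebra
  enumeration n = ⟦ enumerate n ⟧ v , enumerate n , refl

  enumeration-onto : ∀ a → ∃[ n ] S4Algebra._≈_ subalgebra (enumeration n) a
  enumeration-onto (a , φ , e) =
    let n , eq = enumerate-onto φ
    in n , trans (reflexive (≡.cong (λ ψ → ⟦ ψ ⟧ v) eq)) e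

id-iso : (H : HA ℓ) → HeytingIso H H
id-iso H = record
  { to         = λ a → a
  ; to-cong    = λ e → e
  ; injective  = λ e → e
  ; surjective = λ a → a , λ e → e
  ; to-⊤       = refl
  ; to-⊥       = refl
  ; to-∧       = λ _ _ → refl
  ; to-∨       = λ _ _ → refl
  ; to-⇨       = λ _ _ → refl
  }
  where open HeytingAlgebra.Eq H

-- To evaluate φ[s][□p] at v, restrict to the subalgebra generated by v and
-- then to the hull of its opens, which contains every □ (v p).
Log-envelopes⊆Schem : ExcludedMiddle ℓ → (V : Ξ-S4 ℓ k) →
  Log (Envelope (members V)) ⊆ Schem (Log (members V) ^□)
Log-envelopes⊆Schem em V {φ} valid s B B∈V v =
  B.trans (B.reflexive (Evaluation.⟦⟧-[] B (φ [ s ]) _))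
    (hom-≈⊤ {B = B} G.inclusion-hom (φ [ s ]) (proj₁ ∘ w)
      (hom-≈⊤ {B = G.subalgebra} hull-hom (φ [ s ]) w
        (≡.subst (A._≈ A.⊤) (≡.sym (Evaluation.⟦⟧-[] hull φ s)) (valid hull hull∈ _))))
  where
  module B = S4Algebra B
  module G = GeneratedSubalgebra B v
  module B′ = S4Algebra G.subalgebra
  open OpenHull em G.subalgebra
  module A = S4Algebra hull

  w : ℕ → A.Carrier
  w p = ι (B′.□ G.generator p , B.sym (Evaluation.□-idem B (v p)))

  hull∈ : hull ∈ Envelope (members V)
  hull∈ = opens G.subalgebra
        , (G.subalgebra , Ξ-S4.𝕊-closed V (B , B∈V , G.inclusion) , id-iso _)
        , hull-isEnvelope G.enumeration G.enumeration-onto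

Log-σρ : ExcludedMiddle ℓ → (V : Ξ-S4 ℓ k) →
  Log (σ (ρᵃ (members V))) ≐ Schem (Log (members V) ^□)
Log-σρ em V =
    (λ {φ} p → Log-envelopes⊆Schem em V {φ} (proj₁ (Log-HSP (Envelope (members V))) {φ} p))
  , (λ {φ} p → proj₂ (Log-HSP (Envelope (members V))) {φ} (Schem⊆Log-envelopes (members V) {φ} p))

corollary6p8 : ∀ {ℓ k m} →
    (ExcludedMiddle ℓ → ∀ (K : Ξ-S4 ℓ k) →
    Log (σ (ρᵃ (members K))) ≐ Schem (Log (members K) ^□)) ×
    (∀ (L : NExtS4 m) →
    □-maximal L ⇔ IsGreatestModalCompanion L (ρ L))
corollary6p8 = Log-σρ , □-maximal⇔greatest
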